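{- Consider the faulty-starter delivery problem described in the context, with finisher starting position $(x,y)\neq(0,0)$, $y\ge0$. The hybrid algorithm $\mathcal{H}$ described in the context is optimal: for every online algorithm $\mathcal{A}$, $\mathrm{CR}_{\mathcal{H}}\le\mathrm{CR}_{\mathcal{A}}$.
   Context: Setting. In the plane let $S=(0,0)$ and $T=(1,0)$. A "starter" drone carrying a package starts at $S$ at time $0$ and moves at unit speed along $\overline{ST}$ towards $T$. At an unknown time $t\in[0,1]$ it fails and stays forever at $(t,0)$ with the package (at time $s$ the package is at $(\min\{s,t\},0)$). A "finisher" drone starts at time $0$ at $P=(x,y)$ with $y\ge0$, moves at unit speed and can stop and turn instantaneously. The package can be handed over only when the drones are co-located; it is delivered at the first time the finisher, carrying the package, is at $T$. An online algorithm $\mathcal{A}$ specifies the finisher's trajectory using only $(x,y)$ (not $t$); $A(t)$ is its delivery time for fail time $t$. $\mathrm{Opt}(t)=\max\{1,\sqrt{(x-t)^2+y^2}+1-t\}$ is the optimal offline delivery time. $\mathrm{CR}_{\mathcal{A}}(t)=A(t)/\mathrm{Opt}(t)$ and $\mathrm{CR}_{\mathcal{A}}=\sup_{0\le t\le1}\mathrm{CR}_{\mathcal{A}}(t)$. Candidate algorithms. $\mathcal{A}_0$: the finisher goes straight to $S$, then along $\overline{ST}$ towards $T$ until it finds the package, then on to $T$. $\mathcal{A}_1$: the finisher goes straight to $T$, then along the segment towards $S$ until it finds the package, then returns to $T$. $\mathcal{A}_d$ (for $x>0$): with $d=(x^2+y^2)/(2x)$, the finisher goes straight to $(d,0)$,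 then towards $S$ along the segment until it finds the package, then goes to $T$. Hybrid algorithm $\mathcal{H}$: if $(x-1)^2+y^2>1$, execute $\mathcal{A}_0$ if $\mathrm{CR}_{\mathcal{A}_0}\le\mathrm{CR}_{\mathcal{A}_1}$ and $\mathcal{A}_1$ otherwise; if $(x-1)^2+y^2\le1$, execute $\mathcal{A}_0$ if $\mathrm{CR}_{\mathcal{A}_0}\le\mathrm{CR}_{\mathcal{A}_d}$ and $\mathcal{A}_d$ otherwise. -}

module Defs where

open import Level using (0ℓ)
open import Algebra.Bundles using (Ring)
import Algebra.Properties.Ring as RingProperties
open import Algebra.Structures using (IsCommutativeRing)
open import Axiom.ExcludedMiddle using (ExcludedMiddle)
open import Data.Bool.Base using (if_then_else_)
open import Data.Empty using (⊥-elim)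
open import Data.Product.Base using (∃; _×_; _,_; proj₁; proj₂)
open import Data.Sum.Base using (inj₁; inj₂)
open import Function.Bundles using (_⇔_)
open import Relation.Binary.Bundles using (TotalOrder)
open import Relation.Binary.PropositionalEquality.Core using (_≡_; _≢_; refl; trans; subst; subst₂)
open import Relation.Binary.Structures using (IsTotalOrder)
open import Relation.Nullary.Decidable.Core using (yes; no; does)

-- The real numbers, axiomatised as a Dedekind-complete ordered field; these
-- axioms determine ℝ up to isomorphism.  0# ⁻¹ is left unspecified.
record CompleteOrderedField : Set₁ where
  infix  8 _⁻¹
  infix  8 -_
  infixl 7 _*_
  infixl 6 _+_
  infix  4 _≤_
  field
    Carrier           : Set
    _+_ _*_           : Carrier → Carrier → Carrier
    -_ _⁻¹            : Carrier → Carrier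
    0# 1#             : Carrier
    _≤_               : Carrier → Carrier → Set
    isCommutativeRing : IsCommutativeRing _≡_ _+_ _*_ -_ 0# 1#
    0≢1               : 0# ≢ 1#
    *-inverseʳ        : ∀ x → x ≢ 0# → x * x ⁻¹ ≡ 1#
    isTotalOrder      : IsTotalOrder _≡_ _≤_
    +-monoˡ-≤         : ∀ z {x y} → x ≤ y → x + z ≤ y + z
    *-nonneg          : ∀ {x y} → 0# ≤ x → 0# ≤ y → 0# ≤ x * y

  UpperBound : (Carrier → Set) → Carrier → Set
  UpperBound S b = ∀ r → S r → r ≤ b

  field
    complete : (S : Carrier → Set) → ∃ S → ∃ (UpperBound S) →
               ∃ λ c → UpperBound S c × (∀ b → UpperBound S b → c ≤ b)

  totalOrder : TotalOrder 0ℓ 0ℓ 0ℓ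
  totalOrder = record { isTotalOrder = isTotalOrder }

module FaultyStarter (em : ExcludedMiddle 0ℓ) (reals : CompleteOrderedField) where

  open CompleteOrderedField reals public renaming (Carrier to ℝ)
  open import Algebra.Construct.NaturalChoice.Max totalOrder public using (_⊔_)
  open import Algebra.Construct.NaturalChoice.Min totalOrder public using (_⊓_)
  open import Relation.Binary.Construct.NonStrictToStrict _≡_ _≤_ public using (_<_)

  infixl 6 _-_
  _-_ : ℝ → ℝ → ℝ
  a - b = a + (- b)

  infixl 7 _/_
  _/_ : ℝ → ℝ → ℝ
  a / b = a * b ⁻¹

  sq : ℝ → ℝ
  sq a = a * a

  ifᵖ_then_else_ : {A : Set} → Set → A → A → A
  ifᵖ Q then a else b = if does (em {Q}) then a else b

  -- The nonnegative root; it exists for every a ≥ 0 by completeness, so the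
  -- second clause only concerns a < 0.
  √_ : ℝ → ℝ
  √ a with em {∃ λ r → 0# ≤ r × sq r ≡ a}
  ... | yes (r , _) = r
  ... | no _        = 0#

  -- Delivery times and competitive ratios may be infinite, since a finisher
  -- need not ever deliver the package.
  data ℝ∞ : Set where
    fin : ℝ → ℝ∞
    ∞   : ℝ∞

  infix 4 _≤∞_
  data _≤∞_ : ℝ∞ → ℝ∞ → Set where
    fin≤fin : ∀ {a b} → a ≤ b → fin a ≤∞ fin b
    ≤∞-top  : ∀ {v} → v ≤∞ ∞

  infixl 7 _/∞_
  _/∞_ : ℝ∞ → ℝ → ℝ∞
  fin a /∞ b = fin (a / b)
  ∞     /∞ _ = ∞

  IsSup : {I : Set} → (I → ℝ∞) → ℝ∞ → Set
  IsSup f c = (∀ i → f i ≤∞ c) × (∀ b → (∀ i → f i ≤∞ b) → c ≤∞ b)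

  sup-exists : {I : Set} → I → (f : I → ℝ∞) → ∃ (IsSup f)
  sup-exists {I} i₀ f with em {∃ λ b → ∀ i → f i ≤∞ fin b}
  ... | no unbounded = ∞ , (λ _ → ≤∞-top) , least
    where
    least : ∀ b → (∀ i → f i ≤∞ b) → ∞ ≤∞ b
    least (fin b) ub = ⊥-elim (unbounded (b , ub))
    least ∞       _  = ≤∞-top
  ... | yes (b , ub) = fin c , upper , least
    where
    S : ℝ → Set
    S r = ∃ λ i → f i ≡ fin r

    finite : ∀ v → v ≤∞ fin b → ∃ λ r → v ≡ fin r
    finite (fin r) _ = r , refl

    unfin : ∀ {r r′} → fin r ≤∞ fin r′ → r ≤ r′
    unfin (fin≤fin p) = p

    bounds : ∀ b′ → (∀ i → f i ≤∞ fin b′) → UpperBound S b′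
    bounds b′ ub′ r (i , eq) = unfin (subst (_≤∞ fin b′) eq (ub′ i))

    inhabited : ∃ S
    inhabited = let (r , eq) = finite (f i₀) (ub i₀) in r , i₀ , eq

    lub : ∃ λ c → UpperBound S c × (∀ b′ → UpperBound S b′ → c ≤ b′)
    lub = complete S inhabited (b , bounds b ub)

    c : ℝ
    c = proj₁ lub

    below : ∀ v → (∀ r → v ≡ fin r → r ≤ c) → v ≤∞ fin b → v ≤∞ fin c
    below (fin r) le _ = fin≤fin (le r refl)

    upper : ∀ i → f i ≤∞ fin c
    upper i = below (f i) (λ r eq → proj₁ (proj₂ lub) r (i , eq)) (ub i)

    least : ∀ b′ → (∀ i → f i ≤∞ b′) → fin c ≤∞ b′
    least (fin b′) ub′ = fin≤fin (proj₂ (proj₂ lub) b′ (bounds b′ ub′))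
    least ∞        _   = ≤∞-top

  IsFirst : (ℝ → Set) → ℝ → Set
  IsFirst E m = E m × (∀ s → E s → m ≤ s)

  -- ∞ if there is no first time at which E holds.
  firstTime : (ℝ → Set) → ℝ∞
  firstTime E with em {∃ (IsFirst E)}
  ... | yes (m , _) = fin m
  ... | no _        = ∞

  Point : Set
  Point = ℝ × ℝ

  dist : Point → Point → ℝ
  dist (a , b) (c , d) = √ (sq (a - c) + sq (b - d))

  S T : Point
  S = 0# , 0#
  T = 1# , 0#

  InUnit : ℝ → Set
  InUnit t = 0# ≤ t × t ≤ 1#

  package : (t s : ℝ) → Point
  package t s = s ⊓ t , 0#

  -- A t s is the finisher's position at time s ≥ 0 when the fail time is t.
  Algorithm : Set
  Algorithm = ℝ → ℝ → Point

  CoLocated : Algorithm → (t s : ℝ) → Set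
  CoLocated A t s = A t s ≡ package t s

  -- Without knowing t, the finisher can base its motion only on what it has
  -- encountered so far: if for two fail times it has been co-located with the
  -- package at the same moments before s, then its position at s is the same.
  -- Since it may stop, unit speed bounds the speed from above.
  record IsOnline (P : Point) (A : Algorithm) : Set where
    field
      start  : ∀ t → InUnit t → A t 0# ≡ P
      speed  : ∀ t → InUnit t → ∀ s s′ → 0# ≤ s → s ≤ s′ →
               dist (A t s) (A t s′) ≤ s′ - s
      online : ∀ t t′ → InUnit t → InUnit t′ → ∀ s → 0# ≤ s →
               (∀ u → 0# ≤ u → u < s → CoLocated A t u ⇔ CoLocated A t′ u) →
               A t s ≡ A t′ s

  -- The package has been handed over at some u ≤ s and the finisher is at T.
  DeliveredAt : Algorithm → (t s : ℝ) → Set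
  DeliveredAt A t s =
    0# ≤ s × A t s ≡ T × ∃ λ u → 0# ≤ u × u ≤ s × CoLocated A t u

  deliveryTime : Algorithm → ℝ → ℝ∞
  deliveryTime A t = firstTime (DeliveredAt A t)

  Opt : Point → ℝ → ℝ
  Opt (x , y) t = 1# ⊔ (√ (sq (x - t) + sq y) + 1# - t)

  CRat : Point → Algorithm → ℝ → ℝ∞
  CRat P A t = deliveryTime A t /∞ Opt P t

  0≤1 : 0# ≤ 1#
  0≤1 with IsTotalOrder.total isTotalOrder 0# 1#
  ... | inj₁ p = p
  ... | inj₂ p = subst (0# ≤_) (trans (-1*x≈-x (- 1#)) (-‿involutive 1#)) (*-nonneg 0≤-1 0≤-1)
    where
    ring : Ring 0ℓ 0ℓ
    ring = record { isRing = IsCommutativeRing.isRing isCommutativeRing }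
    open Ring ring using (-‿inverseʳ; +-identityˡ)
    open RingProperties ring using (-1*x≈-x; -‿involutive)

    0≤-1 : 0# ≤ - 1#
    0≤-1 = subst₂ _≤_ (-‿inverseʳ 1#) (+-identityˡ (- 1#)) (+-monoˡ-≤ (- 1#) p)

  CR : Point → Algorithm → ℝ∞
  CR P A = proj₁ (sup-exists {∃ InUnit} (1# , 0≤1 , IsTotalOrder.refl isTotalOrder)
                             (λ (t , _) → CRat P A t))

  -- Unit-speed motion along the segment from p to q, started at time 0 and
  -- staying at q after arrival.
  straight : (p q : Point) → ℝ → Point
  straight p@(a , b) q@(c , d) s =
    ifᵖ dist p q ≤ s
      then q
      else (a + s / dist p q * (c - a) , b + s / dist p q * (d - b))

  straightVia : (p q r : Point) → ℝ → Point
  straightVia p q r s =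
    ifᵖ s ≤ dist p q then straight p q s else straight q r (s - dist p q)

  -- Follow the path γ until the package is found, then go straight to T.
  searchAlong : (ℝ → Point) → Algorithm
  searchAlong γ t s with em {∃ λ m → m ≤ s × IsFirst (λ u → 0# ≤ u × γ u ≡ package t u) m}
  ... | yes (m , _) = straight (γ m) T (s - m)
  ... | no _        = γ s

  𝓐₀ 𝓐₁ 𝓐d : Point → Algorithm
  𝓐₀ P         = searchAlong (straightVia P S T)
  𝓐₁ P         = searchAlong (straightVia P T S)
  𝓐d P@(x , y) = searchAlong (straightVia P (d , 0#) S)
    where
    d : ℝ
    d = (sq x + sq y) / ((1# + 1#) * x)

  hybrid : Point → Algorithm
  hybrid P@(x , y) =
    ifᵖ 1# < sq (x - 1#) + sq y
      then (ifᵖ CR P (𝓐₀ P) ≤∞ CR P (𝓐₁ P) then 𝓐₀ P else 𝓐₁ P)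
      else (ifᵖ CR P (𝓐₀ P) ≤∞ CR P (𝓐d P) then 𝓐₀ P else 𝓐d P)

{-# OPTIONS --safe #-}
-- Let f(t) = |P − (t,0)|, g(t) = f(t) + 1 − t and r = |PS|.  Put e = 1 if |PT| > 1 and e = d
-- otherwise, and ρ = |P − (e,0)|.  Going first to (e,0) and then back towards S delivers at
-- K(t) = ρ + e + 1 − 2t when t ≤ e (and optimally when t > e), while 𝓐₀ delivers at r + 1.
-- Suppose an online algorithm delivers within c · Opt(t) for every t, and let m(t) be its first
-- meeting time with the package; until then it cannot distinguish fail times.
--   * If m(0) ≤ m(1), it is at S before T, so r + 1 ≤ c · Opt(1) and 𝓐₀ is at least as good.
--   * If m(1) ≤ m(t) for a t < e, it has to turn back from a point at or beyond (e,0), so that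
--     K(t) ≤ c · Opt(t).
--   * If m(t) ≤ m(1) ≤ m(0), it visits (t,0), then T, then S, so g(t) + 2 ≤ c (r + 1).  Then
--     K(t) ≤ c · g(t) because K(t) (r + 1) ≤ g(t) (g(t) + 2), a consequence of Stewart's theorem
--     for S, (t,0), (e,0) when 2r² ≥ 1; otherwise c ≥ r + 1 and 𝓐₀ is at least as good.
-- This is for y > 0; if y = 0, then 𝓐₀ attains Opt(t) for every t.
module Submission where

open import Defs
open import Level using (0ℓ)
open import Algebra.Bundles using (CommutativeRing)
import Algebra.Properties.Ring as RingProperties
import Algebra.Properties.Semiring.Mult.TCOptimised as Multiples
import Algebra.Solver.Ring as RingSolver
open import Algebra.Solver.Ring.AlmostCommutativeRing using (fromCommutativeRing; _-Raw-AlmostCommutative⟶_)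
open import Axiom.ExcludedMiddle using (ExcludedMiddle)
open import Data.Empty using (⊥-elim)
open import Data.Integer.Base as ℤ using (ℤ; +_; -[1+_])
import Data.Integer.Properties as ℤ
open import Data.Maybe.Base as Maybe using (Maybe)
open import Data.Nat.Base as ℕ using (zero; suc)
import Data.Nat.Properties as ℕ
open import Data.Product.Base using (∃; _×_; _,_; proj₁; proj₂)
open import Data.Sum.Base as Sum using (_⊎_; inj₁; inj₂; [_,_]′)
open import Function.Base using (id)
open import Function.Bundles using (mk⇔)
open import Relation.Binary.PropositionalEquality using (_≡_; _≢_; refl; sym; trans; cong; cong₂; subst; subst₂)
open import Relation.Binary.Structures using (IsTotalOrder)
open import Relation.Nullary.Decidable.Core using (yes; no; dec⇒maybe)
open import Relation.Nullary.Negation.Core using (¬_)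

-- Coefficients are integers because equality of elements of R does not compute, so terms such
-- as x − x would not cancel with coefficients in R.
module IntegerCoefficients (R : CommutativeRing 0ℓ 0ℓ) where

  open CommutativeRing R renaming (refl to ≈-refl; sym to ≈-sym; trans to ≈-trans; zero to *-zero)
  open RingProperties ring
  open Multiples semiring using (1+×; ×-homo-+; ×1-homo-*) renaming (_×_ to _·_)
  open import Relation.Binary.Reasoning.Setoid setoid

  fromℤ : ℤ → Carrier
  fromℤ (+ n)    = n · 1#
  fromℤ -[1+ n ] = - (suc n · 1#)

  -- The recursion of `ℤ.⊖` removes a `suc` from both arguments; this is that step carried out in
  -- `R`.
  cancel-1+ : ∀ a b → a - b ≈ (1# + a) - (1# + b)
  cancel-1+ a b = begin
    a - b                     ≈⟨ +-identityˡ _ ⟨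
    0# + (a - b)              ≈⟨ +-congʳ (-‿inverseʳ 1#) ⟨
    (1# - 1#) + (a - b)       ≈⟨ +-assoc _ _ _ ⟩
    1# + (- 1# + (a - b))     ≈⟨ +-congˡ (+-assoc _ _ _) ⟨
    1# + ((- 1# + a) - b)     ≈⟨ +-congˡ (+-congʳ (+-comm _ _)) ⟩
    1# + ((a - 1#) - b)       ≈⟨ +-congˡ (+-assoc _ _ _) ⟩
    1# + (a + (- 1# - b))     ≈⟨ +-assoc _ _ _ ⟨
    (1# + a) + (- 1# - b)     ≈⟨ +-congˡ (-‿+-comm 1# b) ⟩
    (1# + a) - (1# + b)       ∎

  fromℤ-⊖ : ∀ m n → fromℤ (m ℤ.⊖ n) ≈ (m · 1#) - (n · 1#)
  fromℤ-⊖ zero    zero    = ≈-sym (-‿inverseʳ 0#)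
  fromℤ-⊖ zero    (suc n) = ≈-sym (+-identityˡ _)
  fromℤ-⊖ (suc m) zero    = ≈-sym (≈-trans (+-congˡ -0#≈0#) (+-identityʳ _))
  fromℤ-⊖ (suc m) (suc n) = begin
    fromℤ (suc m ℤ.⊖ suc n)                ≡⟨ cong fromℤ (ℤ.[1+m]⊖[1+n]≡m⊖n m n) ⟩
    fromℤ (m ℤ.⊖ n)                        ≈⟨ fromℤ-⊖ m n ⟩
    (m · 1#) - (n · 1#)                    ≈⟨ cancel-1+ _ _ ⟩
    (1# + m · 1#) - (1# + n · 1#)          ≈⟨ +-cong (1+× m 1#) (-‿cong (1+× n 1#)) ⟨
    (suc m · 1#) - (suc n · 1#)            ∎

  fromℤ-+ : ∀ i j → fromℤ (i ℤ.+ j) ≈ fromℤ i + fromℤ j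
  fromℤ-+ (+ m)    (+ n)    = ×-homo-+ 1# m n
  fromℤ-+ (+ m)    -[1+ n ] = fromℤ-⊖ m (suc n)
  fromℤ-+ -[1+ m ] (+ n)    = ≈-trans (fromℤ-⊖ n (suc m)) (+-comm _ _)
  fromℤ-+ -[1+ m ] -[1+ n ] = begin
    - (suc (suc (m ℕ.+ n)) · 1#)          ≡⟨ cong (λ k → - (k · 1#)) (sym
      (cong suc (ℕ.+-suc m n))) ⟩
    - ((suc m ℕ.+ suc n) · 1#)            ≈⟨ -‿cong (×-homo-+ 1# (suc m) (suc n)) ⟩
    - (suc m · 1# + suc n · 1#)           ≈⟨ -‿+-comm _ _ ⟨
    - (suc m · 1#) - (suc n · 1#)         ∎

  fromℤ-neg : ∀ i → fromℤ (ℤ.- i) ≈ - fromℤ i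
  fromℤ-neg (+ zero)  = ≈-sym -0#≈0#
  fromℤ-neg (+ suc n) = ≈-refl
  fromℤ-neg -[1+ n ]  = ≈-sym (-‿involutive _)

  fromℤ-+* : ∀ m n → fromℤ (+ m ℤ.* + n) ≈ (m · 1#) * (n · 1#)
  fromℤ-+* m n = ≈-trans (reflexive (cong fromℤ (sym (ℤ.pos-* m n)))) (×1-homo-* m n)

  fromℤ-* : ∀ i j → fromℤ (i ℤ.* j) ≈ fromℤ i * fromℤ j
  fromℤ-* (+ m)    (+ n)    = fromℤ-+* m n
  fromℤ-* (+ m)    -[1+ n ] = begin
    fromℤ (+ m ℤ.* -[1+ n ])        ≡⟨ cong fromℤ (sym (ℤ.neg-distribʳ-* (+ m) (+ suc n))) ⟩
    fromℤ (ℤ.- (+ m ℤ.* + suc n))   ≈⟨ fromℤ-neg (+ m ℤ.* + suc n) ⟩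
    - fromℤ (+ m ℤ.* + suc n)       ≈⟨ -‿cong (fromℤ-+* m (suc n)) ⟩
    - ((m · 1#) * (suc n · 1#))     ≈⟨ -‿distribʳ-* _ _ ⟩
    (m · 1#) * - (suc n · 1#)       ∎
  fromℤ-* -[1+ m ] (+ n)    = begin
    fromℤ (-[1+ m ] ℤ.* + n)        ≡⟨ cong fromℤ (sym (ℤ.neg-distribˡ-* (+ suc m) (+ n))) ⟩
    fromℤ (ℤ.- (+ suc m ℤ.* + n))   ≈⟨ fromℤ-neg (+ suc m ℤ.* + n) ⟩
    - fromℤ (+ suc m ℤ.* + n)       ≈⟨ -‿cong (fromℤ-+* (suc m) n) ⟩
    - ((suc m · 1#) * (n · 1#))     ≈⟨ -‿distribˡ-* _ _ ⟩
    - (suc m · 1#) * (n · 1#)       ∎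
  fromℤ-* -[1+ m ] -[1+ n ] = begin
    (suc m ℕ.* suc n) · 1#              ≈⟨ ×1-homo-* (suc m) (suc n) ⟩
    (suc m · 1#) * (suc n · 1#)         ≈⟨ -‿involutive _ ⟨
    - - ((suc m · 1#) * (suc n · 1#))   ≈⟨ -‿cong (-‿distribˡ-* _ _) ⟩
    - (- (suc m · 1#) * (suc n · 1#))   ≈⟨ -‿distribʳ-* _ _ ⟩
    - (suc m · 1#) * - (suc n · 1#)     ∎

  homomorphism : ℤ.+-*-rawRing -Raw-AlmostCommutative⟶ fromCommutativeRing R
  homomorphism = record
    { ⟦_⟧    = fromℤ
    ; +-homo = fromℤ-+
    ; *-homo = fromℤ-*
    ; -‿homo = fromℤ-neg
    ; 0-homo = ≈-refl
    ; 1-homo = ≈-refl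
    }

  coefficient≟ : ∀ i j → Maybe (fromℤ i ≈ fromℤ j)
  coefficient≟ i j = Maybe.map (λ i≡j → reflexive (cong fromℤ i≡j)) (dec⇒maybe (i ℤ.≟ j))

  open RingSolver ℤ.+-*-rawRing (fromCommutativeRing R) homomorphism coefficient≟ public
    using (solve; _:=_; _:+_; _:*_; _:-_; :-_; con; Polynomial)

module Optimality (em : ExcludedMiddle 0ℓ) (reals : CompleteOrderedField) where

  open FaultyStarter em reals

  open import Algebra.Construct.NaturalChoice.Min totalOrder using (x≤y⇒x⊓y≈x; x≤y⇒y⊓x≈x; x⊓y≤x; x⊓y≤y; ⊓-glb; ⊓-monoˡ-≤)
  open import Algebra.Construct.NaturalChoice.Max totalOrder using (x≤y⇒x⊔y≈y; x≤x⊔y; x≤y⊔x; ⊔-lub)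

  commutativeRing : CommutativeRing 0ℓ 0ℓ
  commutativeRing = record { isCommutativeRing = isCommutativeRing }

  open CommutativeRing commutativeRing
    using (*-comm; *-assoc; zeroˡ; zeroʳ; *-identityˡ; *-identityʳ; +-identityˡ; +-identityʳ; -‿inverseʳ)
  open IsTotalOrder isTotalOrder
    using (total) renaming (refl to ≤-refl; reflexive to ≤-reflexive; trans to ≤-trans; antisym to ≤-antisym)
  open IntegerCoefficients commutativeRing using
    (solve; _:=_; _:+_; _:*_; _:-_; :-_; con; Polynomial)

  -- Ordered field arithmetic

  :0 :1 :2 : ∀ {n} → Polynomial n
  :0 = con (+ 0)
  :1 = con (+ 1)
  :2 = con (+ 2)

  -- Inequalities are certified by writing b − a as a combination of quantities known to be
  -- nonnegative: Δ, _⊞_ and _⊠_ build the combination and the ring solver checks the identity.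

  infixl 6 _⊞_
  infixl 7 _⊠_

  Δ : ∀ {a b} → a ≤ b → 0# ≤ b - a
  Δ {a} a≤b = subst (_≤ _) (-‿inverseʳ a) (+-monoˡ-≤ (- a) a≤b)

  _⊞_ : ∀ {a b} → 0# ≤ a → 0# ≤ b → 0# ≤ a + b
  _⊞_ {a} {b} 0≤a 0≤b = ≤-trans (subst (0# ≤_) (sym (+-identityˡ b)) 0≤b) (+-monoˡ-≤ b 0≤a)

  _⊠_ : ∀ {a b} → 0# ≤ a → 0# ≤ b → 0# ≤ a * b
  _⊠_ = *-nonneg

  ≤-by : ∀ {a b c} → 0# ≤ c → b - a ≡ c → a ≤ b
  ≤-by {a} {b} {c} 0≤c eq = subst₂ _≤_ (+-identityˡ a) b-a+a≡b (+-monoˡ-≤ a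
    (subst (0# ≤_) (sym eq) 0≤c))
    where
    b-a+a≡b : b - a + a ≡ b
    b-a+a≡b = solve 2 (λ a b → b :- a :+ a := b) refl a b

  ≡-by : ∀ {a b c} → c ≡ 0# → b - a ≡ c → a ≡ b
  ≡-by {a} {b} {c} c≡0 eq =
    ≤-antisym (≤-by (≤-reflexive (sym c≡0)) eq)
              (≤-by (≤-reflexive (sym c≡0)) (trans (trans
                (solve 2 (λ a b → a :- b := :- (b :- a)) refl a b) (cong -_ (trans eq c≡0)))
                                                   (trans (solve 0 (:- :0 := :0) refl) (sym c≡0))))

  ≰⇒≥ : ∀ {a b} → ¬ a ≤ b → b ≤ a
  ≰⇒≥ {a} {b} a≰b with total a b
  ... | inj₁ a≤b = ⊥-elim (a≰b a≤b)
  ... | inj₂ b≤a = b≤a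

  ≰⇒> : ∀ {a b} → ¬ a ≤ b → b < a
  ≰⇒> a≰b = ≰⇒≥ a≰b , λ b≡a → a≰b (≤-reflexive (sym b≡a))

  <⇒≱ : ∀ {a b} → a < b → ¬ b ≤ a
  <⇒≱ (a≤b , a≢b) b≤a = a≢b (≤-antisym a≤b b≤a)

  ≤⊎> : ∀ a b → a ≤ b ⊎ b < a
  ≤⊎> a b with em {a ≤ b}
  ... | yes a≤b = inj₁ a≤b
  ... | no  a≰b = inj₂ (≰⇒> a≰b)

  <-≤-trans : ∀ {a b c} → a < b → b ≤ c → a < c
  <-≤-trans a<b b≤c = ≰⇒> λ c≤a → <⇒≱ a<b (≤-trans b≤c c≤a)

  ≤-<-trans : ∀ {a b c} → a ≤ b → b < c → a < c
  ≤-<-trans a≤b b<c = ≰⇒> λ c≤a → <⇒≱ b<c (≤-trans c≤a a≤b)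

  Δ< : ∀ {a b} → a < b → 0# < b - a
  Δ< (a≤b , a≢b) = Δ a≤b , λ 0≡b-a → a≢b (≡-by (sym 0≡b-a) refl)

  sq-nonneg : ∀ a → 0# ≤ sq a
  sq-nonneg a with total 0# a
  ... | inj₁ 0≤a = 0≤a ⊠ 0≤a
  ... | inj₂ a≤0 = subst (0# ≤_)
    (solve 1 (λ a → (:0 :- a) :* (:0 :- a) := a :* a) refl a) (Δ a≤0 ⊠ Δ a≤0)

  0<1 : 0# < 1#
  0<1 = 0≤1 , 0≢1

  2# ½ : ℝ
  2# = 1# + 1#
  ½ = 2# ⁻¹

  0≤2 : 0# ≤ 2#
  0≤2 = 0≤1 ⊞ 0≤1

  0<2 : 0# < 2#
  0<2 = 0≤2 , λ 0≡2 → 0≢1 (≤-antisym 0≤1 (subst (1# ≤_) (sym 0≡2) (≤-by 0≤1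
    (solve 0 (:2 :- :1 := :1) refl))))

  >⇒≢ : ∀ {a} → 0# < a → a ≢ 0#
  >⇒≢ (_ , 0≢a) a≡0 = 0≢a (sym a≡0)

  *-cancelˡ-≡0 : ∀ {a b} → a ≢ 0# → a * b ≡ 0# → b ≡ 0#
  *-cancelˡ-≡0 {a} {b} a≢0 ab≡0 =
    trans (sym (*-identityˡ b))
   (trans (cong (_* b) (sym (*-inverseʳ a a≢0)))
   (trans (solve 3 (λ a i b → a :* i :* b := i :* (a :* b)) refl a (a ⁻¹) b)
   (trans (cong (a ⁻¹ *_) ab≡0) (zeroʳ _))))

  -- For `b ≤ 0#` the product is also nonpositive, hence zero, and cancelling `a` leaves `b ≡ 0#`.
  *-cancelˡ-nonneg : ∀ {a b} → 0# < a → 0# ≤ a * b → 0# ≤ b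
  *-cancelˡ-nonneg {a} {b} 0<a 0≤ab with total 0# b
  ... | inj₁ 0≤b = 0≤b
  ... | inj₂ b≤0 = ≤-reflexive (sym (*-cancelˡ-≡0 (>⇒≢ 0<a) (≤-antisym ab≤0 0≤ab)))
    where
    ab≤0 : a * b ≤ 0#
    ab≤0 = ≤-by (proj₁ 0<a ⊠ Δ b≤0) (solve 2 (λ a b → :0 :- a :* b := a :* (:0 :- b)) refl a b)

  *-cancelˡ-≤ : ∀ {a b c} → 0# < c → c * a ≤ c * b → a ≤ b
  *-cancelˡ-≤ {a} {b} {c} 0<c ca≤cb =
    ≤-by (*-cancelˡ-nonneg 0<c (subst (0# ≤_)
      (solve 3 (λ a b c → c :* b :- c :* a := c :* (b :- a)) refl a b c) (Δ ca≤cb))) refl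

  *-pos : ∀ {a b} → 0# < a → 0# < b → 0# < a * b
  *-pos 0<a 0<b = proj₁ 0<a ⊠ proj₁ 0<b , λ 0≡ab → >⇒≢ 0<b (*-cancelˡ-≡0 (>⇒≢ 0<a) (sym 0≡ab))

  ⁻¹-nonneg : ∀ {a} → 0# < a → 0# ≤ a ⁻¹
  ⁻¹-nonneg {a} 0<a = *-cancelˡ-nonneg 0<a (subst (0# ≤_) (sym (*-inverseʳ a (>⇒≢ 0<a))) 0≤1)

  /-cancelʳ : ∀ a {b} → b ≢ 0# → a / b * b ≡ a
  /-cancelʳ a {b} b≢0 = trans (solve 3 (λ a b i → a :* i :* b := a :* (b :* i)) refl a b (b ⁻¹))
    (trans (cong (a *_) (*-inverseʳ b b≢0)) (*-identityʳ a))

  /-≤⇒≤-* : ∀ {a b c} → 0# < b → a / b ≤ c → a ≤ c * b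
  /-≤⇒≤-* {a} {b} {c} 0<b le = subst (_≤ c * b) (/-cancelʳ a (>⇒≢ 0<b))
    (≤-by (Δ le ⊠ proj₁ 0<b) (solve 3 (λ a b c → c :* b :- a :* b := (c :- a) :* b)
      refl (a / b) b c))

  ≤-*⇒/-≤ : ∀ {a b c} → 0# < b → a ≤ c * b → a / b ≤ c
  ≤-*⇒/-≤ {a} {b} {c} 0<b le = *-cancelˡ-≤ 0<b (subst₂ _≤_
    (trans (sym (/-cancelʳ a (>⇒≢ 0<b))) (*-comm _ b)) (*-comm c b) le)

  sq≡0 : ∀ {a} → sq a ≡ 0# → a ≡ 0#
  sq≡0 {a} a²≡0 with em {a ≡ 0#}
  ... | yes a≡0 = a≡0
  ... | no  a≢0 = *-cancelˡ-≡0 a≢0 a²≡0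

  -- If `b ≤ a`, then (a - b)² = (a² - b²) - 2b(a - b) ≤ 0, so the two are equal. Distances are
  -- compared through their squares in this way.
  sq-cancel-≤ : ∀ {a b} → 0# ≤ b → sq a ≤ sq b → a ≤ b
  sq-cancel-≤ {a} {b} 0≤b a²≤b² with total a b
  ... | inj₁ a≤b = a≤b
  ... | inj₂ b≤a = ≤-reflexive (≡-by (sq≡0 (≤-antisym
    (≤-by (Δ a²≤b² ⊞ 0≤2 ⊠ 0≤b ⊠ Δ b≤a)
      (solve 2 (λ a b → :0 :- (b :- a) :* (b :- a) := (b :* b :- a :* a)
        :+ (:2 :* b :* (a :- b))) refl a b))
    (sq-nonneg _))) refl)

  sq-mono-≤ : ∀ {a b} → 0# ≤ a → a ≤ b → sq a ≤ sq b
  sq-mono-≤ {a} {b} 0≤a a≤b = ≤-by (Δ a≤b ⊠ (0≤a ⊞ 0≤a ⊞ Δ a≤b))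
    (solve 2 (λ a b → b :* b :- a :* a := (b :- a) :* (a :+ a :+ (b :- a))) refl a b)

  2*½≡1 : 2# * ½ ≡ 1#
  2*½≡1 = *-inverseʳ 2# (>⇒≢ 0<2)

  -- Square roots and distances

  -- The root is the supremum `c` of the nonnegative numbers with square at most `a`. If c² differs
  -- from `a`, there is a step ε such that c + ε is still in the set or c - ε is still an upper
  -- bound; this forces ε = 0, although ε is a nonzero gap divided by a positive number.
  sqrt-exists : ∀ a → 0# ≤ a → ∃ λ r → 0# ≤ r × sq r ≡ a
  sqrt-exists a 0≤a = c , 0≤c , sq-c≡a
    where
    Below : ℝ → Set
    Below z = 0# ≤ z × sq z ≤ a

    a+1-bounds : UpperBound Below (a + 1#)
    a+1-bounds z (_ , z²≤a) = sq-cancel-≤ (0≤a ⊞ 0≤1) (≤-trans z²≤a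
      (≤-by (0≤a ⊠ 0≤a ⊞ 0≤a ⊞ 0≤1)
        (solve 1 (λ a → (a :+ :1) :* (a :+ :1) :- a := a :* a :+ a :+ :1) refl a)))

    0∈Below : Below 0#
    0∈Below = ≤-refl , subst (_≤ a) (sym (zeroˡ 0#)) 0≤a

    lub : ∃ λ c → UpperBound Below c × (∀ b → UpperBound Below b → c ≤ b)
    lub = complete Below (0# , 0∈Below) (a + 1# , a+1-bounds)

    c : ℝ
    c = proj₁ lub

    c-upper : UpperBound Below c
    c-upper = proj₁ (proj₂ lub)

    0≤c : 0# ≤ c
    0≤c = c-upper 0# 0∈Below

    a≤sq-c : a ≤ sq c
    a≤sq-c with ≤⊎> a (sq c)
    ... | inj₁ a≤c² = a≤c²
    ... | inj₂ c²<a = ⊥-elim (>⇒≢ (Δ< c²<a) (trans (sym εN≡δ) (trans (cong (_* N) ε≡0) (zeroˡ N))))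
      where
      δ N ε : ℝ
      δ = a - sq c
      -- This divisor gives ε ≤ 1, and then 2cε + ε² ≤ ε(2c + 1) ≤ εN = δ.
      N = δ + (c + c + 1#)
      ε = δ / N

      0≤δ : 0# ≤ δ
      0≤δ = Δ (proj₁ c²<a)

      0<N : 0# < N
      0<N = <-≤-trans 0<1 (≤-by (0≤δ ⊞ (0≤c ⊞ 0≤c))
        (solve 2 (λ δ c → δ :+ (c :+ c :+ :1) :- :1 := δ :+ (c :+ c)) refl δ c))

      0≤ε : 0# ≤ ε
      0≤ε = 0≤δ ⊠ ⁻¹-nonneg 0<N

      εN≡δ : ε * N ≡ δ
      εN≡δ = /-cancelʳ δ (>⇒≢ 0<N)

      ε≤1 : ε ≤ 1#
      ε≤1 = ≤-*⇒/-≤ 0<N (≤-by (0≤c ⊞ 0≤c ⊞ 0≤1)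
        (solve 2 (λ δ c → :1 :* (δ :+ (c :+ c :+ :1)) :- δ := c :+ c :+ :1) refl δ c))

      c+ε∈Below : Below (c + ε)
      c+ε∈Below = (0≤c ⊞ 0≤ε) , ≤-by (0≤ε ⊠ 0≤δ ⊞ 0≤ε ⊠ Δ ε≤1 ⊞ Δ (≤-reflexive εN≡δ))
        (solve 3 (λ a c ε → let δ = a :- c :* c in a :- (c :+ ε) :* (c :+ ε)
          := ε :* δ :+ ε :* (:1 :- ε) :+ (δ :- ε :* (δ :+ (c :+ c :+ :1)))) refl a c ε)

      ε≡0 : ε ≡ 0#
      ε≡0 = ≤-antisym (≤-by (Δ (c-upper (c + ε) c+ε∈Below))
        (solve 2 (λ c ε → :0 :- ε := c :- (c :+ ε)) refl c ε)) 0≤ε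

    sq-c≤a : sq c ≤ a
    sq-c≤a with ≤⊎> (sq c) a
    ... | inj₁ c²≤a = c²≤a
    ... | inj₂ a<c² = ⊥-elim (>⇒≢ (Δ< a<c²) (trans (sym εN≡δ) (trans
      (cong (_* (2# * c)) ε≡0) (zeroˡ _))))
      where
      0<c : 0# < c
      0<c = 0≤c , λ 0≡c → <⇒≱ a<c² (subst (λ z → sq z ≤ a) 0≡c (proj₂ 0∈Below))

      δ ε : ℝ
      δ = sq c - a
      -- A Newton step: (c - ε)² = a + ε², so c - ε still bounds the set.
      ε = δ / (2# * c)

      0<2c : 0# < 2# * c
      0<2c = *-pos 0<2 0<c

      0≤ε : 0# ≤ ε
      0≤ε = Δ (proj₁ a<c²) ⊠ ⁻¹-nonneg 0<2c

      εN≡δ : ε * (2# * c) ≡ δ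
      εN≡δ = /-cancelʳ δ (>⇒≢ 0<2c)

      0≤c-ε : 0# ≤ c - ε
      0≤c-ε = *-cancelˡ-nonneg 0<2c (subst (0# ≤_)
        (solve 3 (λ a c ε →
          let δ = c :* c :- a in c :* c :+ a :+ (δ :- ε :* (:2 :* c)) := :2 :* c :* (c :- ε)) refl a c ε)
        (0≤c ⊠ 0≤c ⊞ 0≤a ⊞ Δ (≤-reflexive εN≡δ)))

      c-ε-upper : UpperBound Below (c - ε)
      c-ε-upper z (_ , z²≤a) = sq-cancel-≤ 0≤c-ε (≤-trans z²≤a
        (≤-by (sq-nonneg ε ⊞ Δ (≤-reflexive εN≡δ))
        (solve 3 (λ a c ε → let δ = c :* c :- a in (c :- ε) :* (c :- ε) :- a := ε :* ε :+ (δ :- ε :* (:2 :* c))) refl a c ε)))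

      ε≡0 : ε ≡ 0#
      ε≡0 = ≤-antisym (≤-by (Δ (proj₂ (proj₂ lub) (c - ε) c-ε-upper))
        (solve 2 (λ c ε → :0 :- ε := c :- ε :- c) refl c ε)) 0≤ε

    sq-c≡a : sq c ≡ a
    sq-c≡a = ≤-antisym sq-c≤a a≤sq-c

  √-nonneg : ∀ a → 0# ≤ √ a
  √-nonneg a with em {∃ λ r → 0# ≤ r × sq r ≡ a}
  ... | yes (_ , 0≤r , _) = 0≤r
  ... | no _              = ≤-refl

  sq-√ : ∀ {a} → 0# ≤ a → sq (√ a) ≡ a
  sq-√ {a} 0≤a with em {∃ λ r → 0# ≤ r × sq r ≡ a}
  ... | yes (_ , _ , r²≡a) = r²≡a
  ... | no ∄root           = ⊥-elim (∄root (sqrt-exists a 0≤a))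

  -- Euclidean distances

  dist-nonneg : ∀ p q → 0# ≤ dist p q
  dist-nonneg p q = √-nonneg _

  sq-dist : ∀ a b c d → sq (dist (a , b) (c , d)) ≡ sq (a - c) + sq (b - d)
  sq-dist a b c d = sq-√ (sq-nonneg _ ⊞ sq-nonneg _)

  -- `√_` selects its root through `em`, so a distance is evaluated by exhibiting a nonnegative
  -- number with the right square.
  dist-unique : ∀ {a b c d L} → 0# ≤ L → sq L ≡ sq (a - c) + sq (b - d) → dist (a , b) (c , d) ≡ L
  dist-unique {a} {b} {c} {d} 0≤L eq = ≤-antisym
    (sq-cancel-≤ 0≤L (≤-reflexive (trans (sq-dist a b c d) (sym eq))))
    (sq-cancel-≤ (dist-nonneg _ _) (≤-reflexive (trans eq (sym (sq-dist a b c d)))))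

  -- Travel times are bounded below by displacement in one coordinate. With `dist-axis-triangle`,
  -- this takes the place of a general triangle inequality.
  dist≥₁ : ∀ a b c d → a - c ≤ dist (a , b) (c , d)
  dist≥₁ a b c d = sq-cancel-≤ (dist-nonneg _ _) (subst (sq (a - c) ≤_) (sym (sq-dist a b c d))
    (≤-by (sq-nonneg (b - d)) (solve 2 (λ u v → u :+ v :- u := v) refl (sq (a - c)) (sq (b - d)))))

  dist≥₂ : ∀ a b c d → b - d ≤ dist (a , b) (c , d)
  dist≥₂ a b c d = sq-cancel-≤ (dist-nonneg _ _) (subst (sq (b - d) ≤_) (sym (sq-dist a b c d))
    (≤-by (sq-nonneg (a - c)) (solve 2 (λ u v → u :+ v :- v := u) refl (sq (a - c)) (sq (b - d)))))

  dist-sym : ∀ p q → dist p q ≡ dist q p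
  dist-sym (a , b) (c , d) = cong √_ (solve 4 (λ a b c d →
    (a :- c) :* (a :- c) :+ (b :- d) :* (b :- d) := (c :- a) :* (c :- a)
      :+ (d :- b) :* (d :- b)) refl a b c d)

  dist≡0⇒≡ : ∀ {p q} → dist p q ≡ 0# → p ≡ q
  dist≡0⇒≡ {a , b} {c , d} eq = cong₂ _,_
    (≤-antisym (cmp (dist≥₁ a b c d) eq) (cmp (dist≥₁ c d a b) (trans (dist-sym _ _) eq)))
    (≤-antisym (cmp (dist≥₂ a b c d) eq) (cmp (dist≥₂ c d a b) (trans (dist-sym _ _) eq)))
    where
    cmp : ∀ {u v L} → u - v ≤ L → L ≡ 0# → u ≤ v
    cmp {u} {v} le refl = ≤-by (Δ le) (solve 2 (λ u v → v :- u := :0 :- (u :- v)) refl u v)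

  dist-axis : ∀ {a b} → a ≤ b → dist (a , 0#) (b , 0#) ≡ b - a
  dist-axis {a} {b} a≤b = dist-unique (Δ a≤b) (solve 2 (λ a b →
    (b :- a) :* (b :- a) := (a :- b) :* (a :- b) :+ (:0 :- :0) :* (:0 :- :0)) refl a b)

  -- With f and g the distances to a and b on the axis and δ = b - a, (g + δ)² - f² = 2δ(g - (x -
  -- b)), which is nonnegative by `dist≥₁`. The other bound is its mirror image.
  dist-axis-triangle : ∀ x y {a b} → a ≤ b →
    dist (x , y) (a , 0#) ≤ dist (x , y) (b , 0#) + (b - a) ×
    dist (x , y) (b , 0#) ≤ dist (x , y) (a , 0#) + (b - a)
  dist-axis-triangle x y {a} {b} a≤b =
      sq-cancel-≤ (dist-nonneg _ _ ⊞ Δ a≤b) (≤-by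
        (0≤2 ⊠ (Δ a≤b ⊠ Δ (dist≥₁ x y b 0#)) ⊞ Δ (≤-reflexive (sym (sq-dist x y b 0#)))
          ⊞ Δ (≤-reflexive (sq-dist x y a 0#)))
        (solve 6 (λ x y a b f g → let v = (y :- :0) :* (y :- :0) ; δ = b :- a in
           (g :+ δ) :* (g :+ δ) :- f :* f
           := :2 :* (δ :* (g :- (x :- b))) :+ (g :* g :- ((x :- b) :* (x :- b) :+ v))
             :+ (((x :- a) :* (x :- a) :+ v) :- f :* f))
          refl x y a b (dist (x , y) (a , 0#)) (dist (x , y) (b , 0#))))
    , sq-cancel-≤ (dist-nonneg _ _ ⊞ Δ a≤b) (≤-by
        (0≤2 ⊠ (Δ a≤b ⊠ Δ (subst (a - x ≤_) (dist-sym _ _) (dist≥₁ a 0# x y)))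
          ⊞ Δ (≤-reflexive (sym (sq-dist x y a 0#))) ⊞ Δ (≤-reflexive (sq-dist x y b 0#)))
        (solve 6 (λ x y a b f g → let v = (y :- :0) :* (y :- :0) ; δ = b :- a in
           (f :+ δ) :* (f :+ δ) :- g :* g
           := :2 :* (δ :* (f :- (a :- x))) :+ (f :* f :- ((x :- a) :* (x :- a) :+ v))
             :+ (((x :- b) :* (x :- b) :+ v) :- g :* g))
          refl x y a b (dist (x , y) (a , 0#)) (dist (x , y) (b , 0#))))

  -- The inequality behind the lower bound

  module HandoverInequality
    {t e f r ρ : ℝ} (0≤t : 0# ≤ t) (t≤e : t ≤ e) (e≤1 : e ≤ 1#) (e≤ρ : e ≤ ρ)
    (t≤f : t ≤ f) (0<f : 0# < f) (r≤f+t : r ≤ f + t) (ρ≤f+e-t : ρ ≤ f + (e - t))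
    (stewart : (e - t) * sq r + t * sq ρ ≡ e * sq f + t * e * (e - t))
    (1≤2r² : 1# ≤ 2# * sq r)
    where

    0≤e : 0# ≤ e
    0≤e = ≤-trans 0≤t t≤e

    0≤f : 0# ≤ f
    0≤f = proj₁ 0<f

    0≤δ : 0# ≤ e - t
    0≤δ = Δ t≤e

    -- By `stewart` this quantity equals t(ρ² - e²), and `e ≤ ρ`.
    0≤slack : 0# ≤ e * sq f - (e - t) * sq r - e * sq t
    0≤slack = subst (0# ≤_)
      (solve 5 (λ t e f r ρ →
          t :* ((ρ :- e) :* (ρ :- e :+ (e :+ e))) :+ ((e :* (f :* f)
            :+ t :* e :* (e :- t)) :- ((e :- t) :* (r :* r) :+ t :* (ρ :* ρ)))
          := e :* (f :* f) :- (e :- t) :* (r :* r) :- e :* (t :* t)) refl t e f r ρ)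
      (0≤t ⊠ (Δ e≤ρ ⊠ (Δ e≤ρ ⊞ (0≤e ⊞ 0≤e))) ⊞ Δ (≤-reflexive stewart))

    -- Twice `0≤slack`, with 2r² lowered to 1 and the coefficient e of f² - t² raised to 1.
    f²-bound : (e - t) + 2# * sq t ≤ 2# * sq f
    f²-bound = ≤-by
      (0≤2 ⊠ 0≤slack ⊞ Δ 1≤2r² ⊠ 0≤δ ⊞ 0≤2 ⊠ (Δ e≤1 ⊠ (Δ t≤f ⊠ (Δ t≤f ⊞ (0≤t ⊞ 0≤t)))))
      (solve 4 (λ t e f r →
          :2 :* (f :* f) :- ((e :- t) :+ :2 :* (t :* t))
          := :2 :* (e :* (f :* f) :- (e :- t) :* (r :* r) :- e :* (t :* t))
            :+ (:2 :* (r :* r) :- :1) :* (e :- t)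
             :+ :2 :* ((:1 :- e) :* ((f :- t) :* (f :- t :+ (t :+ t))))) refl t e f r)

    -- With δ = e - t, doubling and inserting `f²-bound` and `t ≤ f` leaves δ + 2t - 4tδ. Since δ +
    -- 2t ≥ e(δ + 2t), this is at least (δ - t)² + tδ + t².
    near-term : 0# ≤ sq f + f * (1# - t) - 2# * (t * (e - t))
    near-term = *-cancelˡ-nonneg 0<2 (subst (0# ≤_)
      (solve 3 (λ t e f →
          (:2 :* (f :* f) :- ((e :- t) :+ :2 :* (t :* t))) :+ :2 :* ((f :- t) :* ((:1 :- e)
            :+ (e :- t)))
          :+ (((e :- t) :- t) :* ((e :- t) :- t) :+ t :* (e :- t) :+ t :* t
            :+ (:1 :- e) :* ((e :- t) :+ :2 :* t))
          := :2 :* (f :* f :+ f :* (:1 :- t) :- :2 :* (t :* (e :- t)))) refl t e f)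
      (Δ f²-bound ⊞ 0≤2 ⊠ (Δ t≤f ⊠ (Δ e≤1 ⊞ 0≤δ))
        ⊞ (sq-nonneg _ ⊞ 0≤t ⊠ 0≤δ ⊞ 0≤t ⊠ 0≤t ⊞ Δ e≤1 ⊠ (0≤δ ⊞ 0≤2 ⊠ 0≤t))))

    -- Compared after squaring, where e · `0≤slack` and 2r² ≥ 1 bound e²f² from below.
    fe-bound : 2# * (t * (e - t)) ≤ f * e
    fe-bound = sq-cancel-≤ (0≤f ⊠ 0≤e) (*-cancelˡ-≤ 0<2 (≤-by
      (0≤2 ⊠ (0≤e ⊠ 0≤slack) ⊞ 0≤e ⊠ 0≤δ ⊠ Δ 1≤2r²
        ⊞ 0≤e ⊠ (0≤δ ⊠ (sq-nonneg (1# - t) ⊞ sq-nonneg t) ⊞ 0≤2 ⊠ (0≤t ⊠ sq-nonneg t))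
        ⊞ 0≤2 ⊠ (0≤t ⊠ 0≤δ ⊠ 0≤e ⊠ Δ e≤1) ⊞ 0≤2 ⊠ (0≤t ⊠ 0≤δ ⊠ sq-nonneg (t - (e - t))))
      (solve 4 (λ t e f r → let δ = e :- t ; w = :2 :* (t :* δ) in
          :2 :* (f :* e :* (f :* e)) :- :2 :* (w :* w)
          := :2 :* (e :* (e :* (f :* f) :- δ :* (r :* r) :- e :* (t :* t)))
            :+ e :* δ :* (:2 :* (r :* r) :- :1)
             :+ e :* (δ :* ((:1 :- t) :* (:1 :- t) :+ t :* t) :+ :2 :* (t :* (t :* t)))
             :+ :2 :* (t :* δ :* e :* (:1 :- e)) :+ :2 :* (t :* δ :* ((t :- δ) :* (t :- δ))))
               refl t e f r)))

    far-term : 0# ≤ f * ρ - 2# * (t * (e - t))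
    far-term = Δ (≤-trans fe-bound (≤-by (0≤f ⊠ Δ e≤ρ)
      (solve 3 (λ e f ρ → f :* ρ :- f :* e := f :* (ρ :- e)) refl e f ρ)))

    -- Written in the two triangle slacks a = f + t - r and b = f + (e - t) - ρ, f times the
    -- difference has nonnegative coefficients by `far-term` and `near-term`. The squares of r and ρ
    -- produced by (e - t)a² and tb² are exactly those that `stewart` eliminates.
    inequality : (ρ + e + 1# - 2# * t) * (r + 1#) ≤ (f + 1# - t) * (f + 1# - t + 2#)
    inequality = *-cancelˡ-≤ 0<f (≤-by
      (Δ r≤f+t ⊠ (far-term ⊞ 0≤f ⊠ Δ e≤1 ⊞ 0≤δ ⊠ Δ r≤f+t)
        ⊞ Δ ρ≤f+e-t ⊠ (near-term ⊞ 0≤t ⊠ Δ ρ≤f+e-t)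
        ⊞ Δ (≤-reflexive stewart)
        ⊞ 0≤2 ⊠ (0≤f ⊠ (0≤f ⊞ (Δ e≤1 ⊞ 0≤δ)) ⊠ Δ e≤1))
      (solve 5 (λ t e f r ρ →
        let δ = e :- t ; g = f :+ :1 :- t ; a = f :+ t :- r ; b = f :+ δ :- ρ in
          f :* (g :* (g :+ :2)) :- f :* ((ρ :+ e :+ :1 :- :2 :* t) :* (r :+ :1))
          := a :* ((f :* ρ :- :2 :* (t :* δ)) :+ f :* (:1 :- e) :+ δ :* a)
             :+ b :* ((f :* f :+ f :* (:1 :- t) :- :2 :* (t :* δ)) :+ t :* b)
             :+ ((e :* (f :* f) :+ t :* e :* δ) :- (δ :* (r :* r) :+ t :* (ρ :* ρ)))
             :+ :2 :* (f :* (f :+ ((:1 :- e) :+ δ)) :* (:1 :- e))) refl t e f r ρ))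

  -- Meetings of an online finisher with the package

  ⊓-lipschitz : ∀ {s s′} t → s ≤ s′ → s′ ⊓ t - s ⊓ t ≤ s′ - s
  ⊓-lipschitz {s} {s′} t s≤s′ with total s t
  ... | inj₁ s≤t = ≤-by (Δ (x⊓y≤x s′ t))
    (solve 3 (λ s s′ m → s′ :- s :- (m :- s) := s′ :- m) refl s s′ (s′ ⊓ t))
  ... | inj₂ t≤s = ≤-by (Δ s≤s′ ⊞ Δ (x⊓y≤y s′ t))
    (solve 4 (λ s s′ t m → s′ :- s :- (m :- t) := (s′ :- s) :+ (t :- m)) refl s s′ t (s′ ⊓ t))

  -- The last component says without an ε that `E` comes arbitrarily close to `c`: if z ≤ 2(s - c)
  -- throughout `E`, then c + z/2 is again a lower bound. The factor 2 leaves room for two motions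
  -- of speed at most 1.
  infimum : (E : ℝ → Set) → ∃ E → (∀ s → E s → 0# ≤ s) →
            ∃ λ c → 0# ≤ c × (∀ s → E s → c ≤ s) × (∀ z → (∀ s → E s → z ≤ 2# * (s - c)) → z ≤ 0#)
  infimum E (u , Eu) E≥0 with complete (λ l → ∀ s → E s → l ≤ s) (0# , E≥0) (u , λ l l≤E → l≤E u Eu)
  ... | c , upper , least = c , upper 0# E≥0 , c≤E , λ z z≤ →
    *-cancelˡ-≤ {c = ½} 0<½ (≤-by (Δ (upper (c + ½ * z) (λ s Es → halved z s (z≤ s Es))))
      (solve 3 (λ c h z → h :* :0 :- h :* z := c :- (c :+ h :* z)) refl c ½ z))
    where
    c≤E : ∀ s → E s → c ≤ s
    c≤E s Es = least s (λ l l≤E → l≤E s Es)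

    0<½ : 0# < ½
    0<½ = ⁻¹-nonneg 0<2 , λ 0≡½ → 0≢1 (trans (sym (zeroʳ 2#)) (trans (cong (2# *_) 0≡½) 2*½≡1))

    halved : ∀ z s → z ≤ 2# * (s - c) → c + ½ * z ≤ s
    halved z s le = *-cancelˡ-≤ 0<2 (≤-by (Δ le ⊞ (≤-reflexive (sym (trans
      (cong (λ h → z - h * z) 2*½≡1) (solve 1 (λ z → z :- :1 :* z := :0) refl z)))))
      (solve 4 (λ c h z s → :2 :* s :- :2 :* (c :+ h :* z) := :2 :* (s :- c) :- z
        :+ (z :- :2 :* h :* z)) refl c ½ z s))

  module Motion {P : Point} {A : Algorithm} (isOnline : IsOnline P A) where

    open IsOnline isOnline

    Met : ℝ → ℝ → Set
    Met t u = 0# ≤ u × CoLocated A t u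

    displacement : ∀ {t} → InUnit t → ∀ {s s′ p q} → 0# ≤ s → s ≤ s′ → A t s ≡ p → A t s′ ≡ q →
      dist p q ≤ s′ - s
    displacement t∈I 0≤s s≤s′ refl refl = speed _ t∈I _ _ 0≤s s≤s′

    reach : ∀ {t} → InUnit t → ∀ {s q} → 0# ≤ s → A t s ≡ q → dist P q ≤ s
    reach t∈I {s} 0≤s eq = subst (_ ≤_)
      (solve 1 (λ s → s :- :0 := s) refl s) (displacement t∈I ≤-refl 0≤s (start _ t∈I) eq)

    -- Both the finisher and the package are 1-Lipschitz, so the meeting times form a closed set.
    first-meeting : ∀ {t} → InUnit t → ∃ (Met t) → ∃ (IsFirst (Met t))
    first-meeting {t} t∈I ∃u = c , (0≤c , cong₂ _,_ (≤-antisym x≤ ≤x) (≤-antisym y≤ ≤y)) , c≤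
      where
      inf : ∃ λ c → 0# ≤ c × (∀ s → Met t s → c ≤ s) × (∀ z → (∀ s → Met t s →
        z ≤ 2# * (s - c)) → z ≤ 0#)
      inf = infimum (Met t) ∃u (λ _ → proj₁)

      c : ℝ
      c = proj₁ inf

      0≤c : 0# ≤ c
      0≤c = proj₁ (proj₂ inf)

      c≤ : ∀ s → Met t s → c ≤ s
      c≤ = proj₁ (proj₂ (proj₂ inf))

      small : ∀ z → (∀ s → Met t s → z ≤ 2# * (s - c)) → z ≤ 0#
      small = proj₂ (proj₂ (proj₂ inf))

      a b : ℝ
      a = proj₁ (A t c)
      b = proj₂ (A t c)

      near : ∀ s → Met t s → dist (a , b) (s ⊓ t , 0#) ≤ s - c
      near s (0≤s , met) = displacement t∈I 0≤c (c≤ s (0≤s , met)) refl met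

      near′ : ∀ s → Met t s → dist (s ⊓ t , 0#) (a , b) ≤ s - c
      near′ s met = subst (_≤ s - c) (dist-sym _ _) (near s met)

      -- Between `c` and a meeting time s the finisher and the package each move by at most s - c,
      -- so their coordinates at `c` differ by at most 2(s - c).
      by-small : ∀ {u v} → (∀ s → Met t s → u - v ≤ 2# * (s - c)) → u ≤ v
      by-small {u} {v} le = ≤-by (Δ (small (u - v) le))
        (solve 2 (λ u v → v :- u := :0 :- (u :- v)) refl u v)

      x≤ : a ≤ c ⊓ t
      x≤ = by-small λ s met → ≤-by
        (Δ (≤-trans (dist≥₁ a b (s ⊓ t) 0#) (near s met)) ⊞ Δ (⊓-lipschitz t (c≤ s met)))
        (solve 5 (λ a s c m n → :2 :* (s :- c) :- (a :- n) := (s :- c :- (a :- m))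
          :+ (s :- c :- (m :- n))) refl a s c (s ⊓ t) (c ⊓ t))

      ≤x : c ⊓ t ≤ a
      ≤x = by-small λ s met → ≤-by
        (Δ (≤-trans (dist≥₁ (s ⊓ t) 0# a b) (near′ s met)) ⊞ Δ (c≤ s met)
          ⊞ Δ (⊓-monoˡ-≤ t (c≤ s met)))
        (solve 5 (λ a s c m n → :2 :* (s :- c) :- (n :- a) := (s :- c :- (m :- a)) :+ (s :- c)
          :+ (m :- n)) refl a s c (s ⊓ t) (c ⊓ t))

      y≤ : b ≤ 0#
      y≤ = by-small λ s met → ≤-by
        (Δ (≤-trans (dist≥₂ a b (s ⊓ t) 0#) (near s met)) ⊞ Δ (c≤ s met))
        (solve 3 (λ b s c → :2 :* (s :- c) :- (b :- :0) := (s :- c :- (b :- :0))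
          :+ (s :- c)) refl b s c)

      ≤y : 0# ≤ b
      ≤y = by-small λ s met → ≤-by
        (Δ (≤-trans (dist≥₂ (s ⊓ t) 0# a b) (near′ s met)) ⊞ Δ (c≤ s met))
        (solve 3 (λ b s c → :2 :* (s :- c) :- (:0 :- b) := (s :- c :- (:0 :- b))
          :+ (s :- c)) refl b s c)

    -- Before `m` neither run has met the package, so the histories coincide. Since `online`
    -- compares only moments strictly before the given one, the positions agree at `m` itself too.
    agree-until-meeting : ∀ {t t′ m m′} → InUnit t → InUnit t′ → IsFirst (Met t) m →
      IsFirst (Met t′) m′ → m ≤ m′ → A t′ m ≡ A t m
    agree-until-meeting {t} {t′} {m} t∈I t′∈I ((0≤m , _) , first) (_ , first′) m≤m′ =
      sym (online t t′ t∈I t′∈I m 0≤m λ u 0≤u u<m → mk⇔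
        (λ met → ⊥-elim (<⇒≱ u<m (first u (0≤u , met))))
        (λ met → ⊥-elim (<⇒≱ u<m (≤-trans m≤m′ (first′ u (0≤u , met))))))

    delivery-after-meeting : ∀ {t m D} → InUnit t → IsFirst (Met t) m → DeliveredAt A t D →
      m + 1# - m ⊓ t ≤ D
    delivery-after-meeting {t} {m} {D} t∈I ((0≤m , met) , first) (_ , atT , u , 0≤u , u≤D , met-u) =
      ≤-by (Δ (≤-trans (dist≥₁ 1# 0# (m ⊓ t) 0#)
        (subst (_≤ D - m) (dist-sym _ _) (displacement t∈I 0≤m (≤-trans (first u
          (0≤u , met-u)) u≤D) met atT))))
           (solve 3 (λ m D v → D :- (m :+ :1 :- v) := D :- m :- (:1 :- v)) refl m D (m ⊓ t))

  -- Competitive ratios and the lower bound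

  Opt≡ : ∀ x y t → Opt (x , y) t ≡ 1# ⊔ (dist (x , y) (t , 0#) + 1# - t)
  Opt≡ x y t = cong (λ v → 1# ⊔ (√ (sq (x - t) + sq v) + 1# - t))
    (solve 1 (λ y → y := y :- :0) refl y)

  1≤Opt : ∀ P t → 1# ≤ Opt P t
  1≤Opt P t = x≤x⊔y 1# _

  0<Opt : ∀ P t → 0# < Opt P t
  0<Opt P t = <-≤-trans 0<1 (1≤Opt P t)

  via≤Opt : ∀ x y t → dist (x , y) (t , 0#) + 1# - t ≤ Opt (x , y) t
  via≤Opt x y t = subst (dist (x , y) (t , 0#) + 1# - t ≤_) (sym (Opt≡ x y t)) (x≤y⊔x 1# _)

  Opt≡via : ∀ {x y t} → t ≤ dist (x , y) (t , 0#) → Opt (x , y) t ≡ dist (x , y) (t , 0#) + 1# - t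
  Opt≡via {x} {y} {t} t≤f = trans (Opt≡ x y t) (x≤y⇒x⊔y≈y
    (≤-by (Δ t≤f) (solve 2 (λ t f → f :+ :1 :- t :- :1 := f :- t) refl t (dist (x , y) (t , 0#)))))

  -- The time of `𝓐₀` does not depend on the fail time when y > 0, so by this bound its ratio is
  -- worst at fail time 1.
  Opt-antitone : ∀ x y {t} → t ≤ 1# → Opt (x , y) 1# ≤ Opt (x , y) t
  Opt-antitone x y {t} t≤1 = subst (_≤ Opt (x , y) t) (sym (Opt≡ x y 1#)) (⊔-lub (1≤Opt (x , y) t)
    (≤-trans (≤-by (Δ (proj₂ (dist-axis-triangle x y t≤1)))
                   (solve 3 (λ q f t → f :+ :1 :- t :- (q :+ :1 :- :1) := f :+ (:1 :- t) :- q)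
                     refl (dist (x , y) T) (dist (x , y) (t , 0#)) t))
             (via≤Opt x y t)))

  ≤∞-trans : ∀ {u v w} → u ≤∞ v → v ≤∞ w → u ≤∞ w
  ≤∞-trans (fin≤fin p) (fin≤fin q) = fin≤fin (≤-trans p q)
  ≤∞-trans _           ≤∞-top      = ≤∞-top

  firstTime-≤ : ∀ {E b c} → firstTime E /∞ b ≤∞ fin c → ∃ λ D → E D × D / b ≤ c
  firstTime-≤ {E} le with em {∃ (IsFirst E)} | le
  ... | yes (D , ED , _) | fin≤fin D/b≤c = D , ED , D/b≤c
  ... | no _             | ()

  firstTime-≤⁻ : ∀ {E b c D} → IsFirst E D → D / b ≤ c → firstTime E /∞ b ≤∞ fin c
  firstTime-≤⁻ {E} {b} {c} {D} isFirst D/b≤c with em {∃ (IsFirst E)}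
  ... | yes (D′ , ED′ , first′) = fin≤fin
    (subst (λ d → d / b ≤ c) (≤-antisym (proj₂ isFirst D′ ED′) (first′ D (proj₁ isFirst))) D/b≤c)
  ... | no ∄first               = ⊥-elim (∄first (D , isFirst))

  -- A bound on `CR` freed of supremum and division. A first delivery time is demanded because
  -- `firstTime` is `∞` if there is none.
  Guarantees : Point → Algorithm → ℝ → Set
  Guarantees P A c = ∀ t → InUnit t → ∃ λ D → IsFirst (DeliveredAt A t) D × D ≤ c * Opt P t

  CR-isSup : ∀ P A → IsSup {∃ InUnit} (λ (t , _) → CRat P A t) (CR P A)
  CR-isSup P A = proj₂ (sup-exists {∃ InUnit} (1# , 0≤1 , ≤-refl) (λ (t , _) → CRat P A t))

  CR≤⇒delivery : ∀ {P A c} → CR P A ≤∞ fin c → ∀ t → InUnit t → ∃ λ D →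
    DeliveredAt A t D × D ≤ c * Opt P t
  CR≤⇒delivery {P} {A} {c} le t t∈I =
    let D , delivered , D/Opt≤c = firstTime-≤ (≤∞-trans (proj₁ (CR-isSup P A) (t , t∈I)) le)
    in D , delivered , /-≤⇒≤-* (0<Opt P t) D/Opt≤c

  guarantees⇒CR≤ : ∀ {P A c} → Guarantees P A c → CR P A ≤∞ fin c
  guarantees⇒CR≤ {P} {A} {c} good = proj₂ (CR-isSup P A) (fin c) λ (t , t∈I) →
    let D , isFirst , D≤ = good t t∈I
    in firstTime-≤⁻ isFirst (≤-*⇒/-≤ (0<Opt P t) D≤)

  -- What a delivery bound `c` forces on an online algorithm

  module LowerBound {x y : ℝ} {A : Algorithm} (isOnline : IsOnline (x , y) A) {c : ℝ}
    (deliver : ∀ t → InUnit t → ∃ λ D → DeliveredAt A t D × D ≤ c * Opt (x , y) t) where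

    open Motion isOnline

    P : Point
    P = x , y

    0∈I : InUnit 0#
    0∈I = ≤-refl , 0≤1

    1∈I : InUnit 1#
    1∈I = 0≤1 , ≤-refl

    meeting : ∀ {t} → InUnit t → ∃ λ m → IsFirst (Met t) m × m + 1# - m ⊓ t ≤ c * Opt P t
    meeting {t} t∈I =
      let D , delivered@(_ , _ , u , 0≤u , _ , met) , D≤ = deliver t t∈I
          m , isFirst = first-meeting t∈I (u , 0≤u , met)
      in m , isFirst , ≤-trans (delivery-after-meeting t∈I isFirst delivered) D≤

    -- At fail time 1 no delivery beats the optimum, which is the larger of 1 and |PT|: the package
    -- takes time 1 to get to T, and the finisher has to reach T.
    1≤c : 1# ≤ c
    1≤c =
      let D , delivered@(0≤D , atT , _) , D≤ = deliver 1# 1∈I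
          m , ((0≤m , met) , first) , _ = meeting 1∈I
          1≤D = ≤-trans (≤-by (Δ (x⊓y≤x m 1#))
            (solve 2 (λ m v → m :+ :1 :- v :- :1 := m :- v) refl m (m ⊓ 1#)))
                        (delivery-after-meeting 1∈I ((0≤m , met) , first) delivered)
          q≤D = ≤-trans (≤-reflexive
            (solve 1 (λ q → q :+ :1 :- :1 := q) refl (dist P T))) (reach 1∈I 0≤D atT)
          Opt≤D = subst (_≤ D) (sym (Opt≡ x y 1#)) (⊔-lub 1≤D q≤D)
      in *-cancelˡ-≤ (0<Opt P 1#) (subst₂ _≤_ (sym (*-identityʳ _)) (*-comm c _) (≤-trans Opt≤D D≤))

    0≤c : 0# ≤ c
    0≤c = ≤-trans 0≤1 1≤c

    -- The far and near cases enter only through these hypotheses, with `e` equal to 1 or d. The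
    -- moving package cannot be intercepted before time `e`, and running straight back to S after a
    -- meeting for fail time 1 ends no earlier than the route via (e,0).
    module Dichotomy {e : ℝ} (0<y : 0# < y) (0≤e : 0# ≤ e) (e≤1 : e ≤ 1#)
      (e≤ρ : e ≤ dist P (e , 0#))
      (moving-meeting≥e : ∀ {m} → 0# ≤ m → m ≤ 1# → dist P (m , 0#) ≤ m → e ≤ m)
      (meeting≥ρ : ∀ {m} → 0# ≤ m → dist P (m ⊓ 1# , 0#) ≤ m → dist P (e , 0#) + e ≤ m + m ⊓ 1#)
      where

      r ρ : ℝ
      r = dist P S
      ρ = dist P (e , 0#)

      m₀ m₁ : ℝ
      m₀ = proj₁ (meeting 0∈I)
      m₁ = proj₁ (meeting 1∈I)

      first₀ : IsFirst (Met 0#) m₀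
      first₀ = proj₁ (proj₂ (meeting 0∈I))

      first₁ : IsFirst (Met 1#) m₁
      first₁ = proj₁ (proj₂ (meeting 1∈I))

      0≤m₀ : 0# ≤ m₀
      0≤m₀ = proj₁ (proj₁ first₀)

      0≤m₁ : 0# ≤ m₁
      0≤m₁ = proj₁ (proj₁ first₁)

      atS : A 0# m₀ ≡ S
      atS = trans (proj₂ (proj₁ first₀)) (cong (_, 0#) (x≤y⇒y⊓x≈x 0≤m₀))

      v : ℝ
      v = m₁ ⊓ 1#

      at-v : A 1# m₁ ≡ (v , 0#)
      at-v = proj₂ (proj₁ first₁)

      e≤v : e ≤ v
      e≤v with total m₁ 1#
      ... | inj₁ m₁≤1 = moving-meeting≥e 0≤m₁ m₁≤1 (reach 1∈I 0≤m₁ (trans at-v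
        (cong (_, 0#) (x≤y⇒x⊓y≈x m₁≤1))))
      ... | inj₂ 1≤m₁ = e≤1

      -- Up to `m₀` the run for fail time 1 agrees with that for fail time 0, so it is at S at a
      -- time `m₀` ≥ r. It has not met its package earlier, and T is still at distance 1.
      S-first : m₀ ≤ m₁ → r + 1# ≤ c * Opt P 1#
      S-first m₀≤m₁ =
        let D , delivered@(_ , atT , u , 0≤u , u≤D , met) , D≤ = deliver 1# 1∈I
            m₀≤D = ≤-trans m₀≤m₁ (≤-trans (proj₂ first₁ u (0≤u , met)) u≤D)
            1≤D-m₀ = ≤-trans (≤-trans (≤-reflexive
              (solve 0 (:1 := :1 :- :0) refl)) (≤-reflexive (sym (dist-axis 0≤1))))
                             (displacement 1∈I 0≤m₀ m₀≤D
                               (trans (agree-until-meeting 0∈I 1∈I first₀ first₁ m₀≤m₁) atS) atT)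
        in ≤-trans (≤-by (Δ (reach 0∈I 0≤m₀ atS) ⊞ Δ 1≤D-m₀)
          (solve 3 (λ D r m → D :- (r :+ :1) := (m :- r) :+ (D :- m :- :1)) refl D r m₀)) D≤

      module TFirst (m₁≤m₀ : m₁ ≤ m₀) (c≤r+1 : c ≤ r + 1#) {t : ℝ} (0≤t : 0# ≤ t)
        (t<e : t < e) where

        t≤e : t ≤ e
        t≤e = proj₁ t<e

        t∈I : InUnit t
        t∈I = 0≤t , ≤-trans t≤e e≤1

        f g mₜ : ℝ
        f = dist P (t , 0#)
        g = f + 1# - t
        mₜ = proj₁ (meeting t∈I)

        firstₜ : IsFirst (Met t) mₜ
        firstₜ = proj₁ (proj₂ (meeting t∈I))

        0≤mₜ : 0# ≤ mₜ
        0≤mₜ = proj₁ (proj₁ firstₜ)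

        -- Otherwise the moving package could be intercepted at time `t`, before `e`. Hence Opt(t) =
        -- g.
        t<f : t < f
        t<f = ≰⇒> λ f≤t → <⇒≱ t<e (moving-meeting≥e 0≤t (proj₂ t∈I) f≤t)

        package-at-t : t ≤ mₜ → A t mₜ ≡ (t , 0#)
        package-at-t t≤mₜ = trans (proj₂ (proj₁ firstₜ)) (cong (_, 0#) (x≤y⇒y⊓x≈x t≤mₜ))

        delivery-t : t ≤ mₜ → mₜ + 1# - t ≤ c * g
        delivery-t t≤mₜ = subst₂ _≤_ (cong (λ w → mₜ + 1# - w) (x≤y⇒y⊓x≈x t≤mₜ))
          (cong (c *_) (Opt≡via (proj₁ t<f))) (proj₂ (proj₂ (meeting t∈I)))

        -- The run for `t` follows the run for fail time 1 to (v,0), returns to (t,0) and then goes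
        -- to T, which takes at least m₁ + (v - t) + (1 - t).
        found-later : m₁ ≤ mₜ → ρ + e + 1# - 2# * t ≤ c * g
        found-later m₁≤mₜ = ≤-trans (≤-by
          (Δ (≤-trans (dist≥₁ v 0# t 0#) (displacement t∈I 0≤m₁ m₁≤mₜ
            (trans (agree-until-meeting 1∈I t∈I first₁ firstₜ m₁≤mₜ) at-v) (package-at-t t≤mₜ)))
            ⊞ Δ (meeting≥ρ 0≤m₁ (reach 1∈I 0≤m₁ at-v)))
          (solve 6 (λ t e ρ m₁ m v → m :+ :1 :- t :- (ρ :+ e :+ :1 :- :2 :* t)
            := (m :- m₁ :- (v :- t)) :+ (m₁ :+ v :- (ρ :+ e))) refl t e ρ m₁ mₜ v))
          (delivery-t t≤mₜ)
          where
          t≤mₜ : t ≤ mₜ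
          t≤mₜ = ≤-trans t≤e (≤-trans e≤v (≤-trans (x⊓y≤x m₁ 1#) m₁≤mₜ))

        module FoundEarlier (mₜ≤m₁ : mₜ ≤ m₁) where

          t≤mₜ : t ≤ mₜ
          t≤mₜ with total t mₜ
          ... | inj₁ t≤mₜ = t≤mₜ
          ... | inj₂ mₜ≤t = ≤-trans t≤e (moving-meeting≥e 0≤mₜ (≤-trans mₜ≤t (proj₂ t∈I))
            (reach t∈I 0≤mₜ (trans (proj₂ (proj₁ firstₜ)) (cong (_, 0#) (x≤y⇒x⊓y≈x mₜ≤t)))))

          f≤mₜ : f ≤ mₜ
          f≤mₜ = reach t∈I 0≤mₜ (package-at-t t≤mₜ)

          v-t≤m₁-mₜ : v - t ≤ m₁ - mₜ
          v-t≤m₁-mₜ = ≤-trans (dist≥₁ v 0# t 0#) (subst (_≤ m₁ - mₜ) (dist-sym _ _)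
            (displacement 1∈I 0≤mₜ mₜ≤m₁
              (trans (agree-until-meeting t∈I 1∈I firstₜ first₁ mₜ≤m₁) (package-at-t t≤mₜ)) at-v))

          -- At time `mₜ` ≥ f > t the run for fail time 1 is at (t,0), behind its package. At unit
          -- speed it cannot catch up before the package stops at T.
          v≡1 : v ≡ 1#
          v≡1 with total m₁ 1#
          ... | inj₂ 1≤m₁ = refl
          ... | inj₁ m₁≤1 = ⊥-elim (<⇒≱ t<f (≤-trans f≤mₜ (≤-by (Δ
            (subst (λ w → w - t ≤ m₁ - mₜ) (x≤y⇒x⊓y≈x m₁≤1) v-t≤m₁-mₜ))
            (solve 3 (λ t m m₁ → t :- m := m₁ :- m :- (m₁ :- t)) refl t mₜ m₁))))

          g≤m₁ : g ≤ m₁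
          g≤m₁ = ≤-by (Δ f≤mₜ ⊞ Δ (subst (λ w → w - t ≤ m₁ - mₜ) v≡1 v-t≤m₁-mₜ))
            (solve 4 (λ t f m m₁ → m₁ :- (f :+ :1 :- t) := (m :- f) :+ (m₁ :- m :- (:1 :- t)))
              refl t f mₜ m₁)

          Opt₀ : Opt P 0# ≡ r + 1#
          Opt₀ = trans (Opt≡via (dist-nonneg _ _)) (solve 1 (λ r → r :+ :1 :- :0 := r :+ :1) refl r)

          -- The run for fail time 0 is also at T at time `m₁` ≥ g. It still has to fetch the
          -- package from S, a round trip of length 2.
          g+2≤c[r+1] : g + 2# ≤ c * (r + 1#)
          g+2≤c[r+1] = ≤-trans (≤-by
            (Δ g≤m₁ ⊞ Δ (≤-trans (dist≥₁ 1# 0# 0# 0#) (displacement 0∈I 0≤m₁ m₁≤m₀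
                (trans (agree-until-meeting 1∈I 0∈I first₁ first₀ m₁≤m₀) (trans at-v
                  (cong (_, 0#) v≡1))) atS)))
            (solve 3 (λ g m₀ m₁ → m₀ :+ :1 :- :0 :- (g :+ :2) := (m₁ :- g)
              :+ (m₀ :- m₁ :- (:1 :- :0))) refl g m₀ m₁))
            (subst₂ _≤_ (cong (λ w → m₀ + 1# - w) (x≤y⇒y⊓x≈x 0≤m₀))
              (cong (c *_) Opt₀) (proj₂ (proj₂ (meeting 0∈I))))

          0≤r : 0# ≤ r
          0≤r = dist-nonneg _ _

          1≤g : 1# ≤ g
          1≤g = ≤-by (Δ (proj₁ t<f)) (solve 2 (λ t f → f :+ :1 :- t :- :1 := f :- t) refl t f)

          -- 3 ≤ g + 2 ≤ c (r + 1) ≤ (r + 1)², which is false when r² < 1/2.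
          1≤2r² : 1# ≤ 2# * sq r
          1≤2r² = ≤-by (Δ 1≤g ⊞ Δ g+2≤c[r+1] ⊞ Δ c≤r+1 ⊠ (0≤r ⊞ 0≤1) ⊞ sq-nonneg (r - 1#))
            (solve 3 (λ r c g → :2 :* (r :* r) :- :1
              := (g :- :1) :+ (c :* (r :+ :1) :- (g :+ :2)) :+ (r :+ :1 :- c) :* (r :+ :1)
                :+ (r :- :1) :* (r :- :1)) refl r c g)

          r≤f+t : r ≤ f + t
          r≤f+t = ≤-trans (proj₁ (dist-axis-triangle x y 0≤t)) (≤-reflexive
            (solve 2 (λ f t → f :+ (t :- :0) := f :+ t) refl f t))

          stewart : (e - t) * sq r + t * sq ρ ≡ e * sq f + t * e * (e - t)
          stewart = trans (cong₂ (λ R Q →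
            (e - t) * R + t * Q) (sq-dist x y 0# 0#) (sq-dist x y e 0#)) (trans
            (solve 4 (λ x y e t → let v = (y :- :0) :* (y :- :0) in
              (e :- t) :* ((x :- :0) :* (x :- :0) :+ v) :+ t :* ((x :- e) :* (x :- e) :+ v)
              := e :* ((x :- t) :* (x :- t) :+ v) :+ t :* e :* (e :- t)) refl x y e t)
            (cong (λ F → e * F + t * e * (e - t)) (sym (sq-dist x y t 0#))))

          0<f : 0# < f
          0<f = <-≤-trans 0<y (≤-trans (≤-reflexive
            (solve 1 (λ y → y := y :- :0) refl y)) (dist≥₂ x y t 0#))

          -- Follows from K(r + 1) ≤ g(g + 2) ≤ g · c(r + 1) by cancelling r + 1.
          found-earlier : ρ + e + 1# - 2# * t ≤ c * g
          found-earlier = *-cancelˡ-≤ (<-≤-trans 0<1 (≤-by 0≤r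
            (solve 1 (λ r → r :+ :1 :- :1 := r) refl r))) (≤-by
            (Δ inequality ⊞ ≤-trans 0≤1 1≤g ⊠ Δ g+2≤c[r+1])
            (solve 4 (λ K r c g → (r :+ :1) :* (c :* g) :- (r :+ :1) :* K
              := (g :* (g :+ :2) :- K :* (r :+ :1)) :+ g :* (c :* (r :+ :1) :- (g :+ :2)))
                refl (ρ + e + 1# - 2# * t) r c g))
            where
            open HandoverInequality 0≤t t≤e e≤1 e≤ρ (proj₁ t<f) 0<f r≤f+t (proj₂
              (dist-axis-triangle x y t≤e)) stewart 1≤2r²

        delivery≥ : ρ + e + 1# - 2# * t ≤ c * g
        delivery≥ with total m₁ mₜ
        ... | inj₁ m₁≤mₜ = found-later m₁≤mₜ
        ... | inj₂ mₜ≤m₁ = FoundEarlier.found-earlier mₜ≤m₁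

      dichotomy : r + 1# ≤ c * Opt P 1# ⊎
                  (∀ t → 0# ≤ t → t < e → ρ + e + 1# - 2# * t ≤ c * (dist P (t , 0#) + 1# - t))
      -- When r + 1 exceeds c · Opt(1), also c ≤ c · Opt(1) < r + 1, which supplies the hypothesis
      -- on `c` in `TFirst`.
      dichotomy with total m₀ m₁ | ≤⊎> (r + 1#) (c * Opt P 1#)
      ... | _          | inj₁ r+1≤ = inj₁ r+1≤
      ... | inj₁ m₀≤m₁ | inj₂ _    = inj₁ (S-first m₀≤m₁)
      ... | inj₂ m₁≤m₀ | inj₂ <r+1 = inj₂ (λ _ →
        TFirst.delivery≥ m₁≤m₀ (≤-trans c≤cOpt₁ (proj₁ <r+1)))
        where
        c≤cOpt₁ : c ≤ c * Opt P 1#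
        c≤cOpt₁ = ≤-by (0≤c ⊠ Δ (1≤Opt P 1#))
          (solve 2 (λ c o → c :* o :- c := c :* (o :- :1)) refl c (Opt P 1#))

  -- Delivery times of the search algorithms

  ifᵖ-elim : {A Q : Set} {a b : A} (M : A → Set) → (Q → M a) → (¬ Q → M b) → M (ifᵖ Q then a else b)
  ifᵖ-elim {Q = Q} M ma mb with em {Q}
  ... | yes q = ma q
  ... | no ¬q = mb ¬q

  ifᵖ-yes : {A Q : Set} {a b : A} → Q → ifᵖ Q then a else b ≡ a
  ifᵖ-yes {a = a} q = ifᵖ-elim (_≡ a) (λ _ → refl) (λ ¬q → ⊥-elim (¬q q))

  ifᵖ-no : {A Q : Set} {a b : A} → ¬ Q → ifᵖ Q then a else b ≡ b
  ifᵖ-no {b = b} ¬q = ifᵖ-elim (_≡ b) (λ q → ⊥-elim (¬q q)) (λ _ → refl)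

  dist-refl : ∀ p → dist p p ≡ 0#
  dist-refl (a , b) = dist-unique ≤-refl
    (solve 2 (λ a b → :0 :* :0 := (a :- a) :* (a :- a) :+ (b :- b) :* (b :- b)) refl a b)

  straight-arrived : ∀ {p q s} → dist p q ≤ s → straight p q s ≡ q
  straight-arrived = ifᵖ-yes

  straight-en-route : ∀ {a b c d s} → let L = dist (a , b) (c , d) in
    ¬ L ≤ s → straight (a , b) (c , d) s ≡ (a + s / L * (c - a) , b + s / L * (d - b))
  straight-en-route = ifᵖ-no

  straight-start : ∀ p q → straight p q 0# ≡ p
  straight-start p@(a , b) q@(c , d) with em {dist p q ≤ 0#}
  ... | yes L≤0 = sym (dist≡0⇒≡ (≤-antisym L≤0 (dist-nonneg p q)))
  ... | no  L≰0 = cong₂ _,_ (stay a c) (stay b d)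
    where
    stay : ∀ u v → u + 0# / dist p q * (v - u) ≡ u
    stay u v = solve 3 (λ u v i → u :+ :0 :* i :* (v :- u) := u) refl u v (dist p q ⁻¹)

  -- With k = s / L < 1 the equation reads (1 - k)(v - u) = 0. It is applied coordinate by
  -- coordinate.
  en-route-fraction : ∀ {s L u v} → 0# ≤ s → s < L → u + s / L * (v - u) ≡ v → u ≡ v
  en-route-fraction {s} {L} {u} {v} 0≤s s<L eq = ≡-by (*-cancelˡ-≡0 1-k≢0 (trans
    (solve 3 (λ k u v → (:1 :- k) :* (v :- u) := v :- (u :+ k :* (v :- u))) refl (s / L) u v)
    (trans (cong (λ z → v - z) eq) (-‿inverseʳ v)))) refl
    where
    1-k≢0 : 1# - s / L ≢ 0#
    1-k≢0 1-k≡0 = <⇒≱ s<L (≤-reflexive (trans (sym (*-identityˡ L)) (trans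
      (cong (_* L) (sym (≡-by 1-k≡0 refl)))
      (/-cancelʳ s (>⇒≢ (≤-<-trans 0≤s s<L))))))

  straight-arrives-only-after-dist : ∀ {p q s} → 0# ≤ s → straight p q s ≡ q → dist p q ≤ s
  straight-arrives-only-after-dist {p@(a , b)} {q@(c , d)} {s} 0≤s eq with ≤⊎> (dist p q) s
  ... | inj₁ L≤s = L≤s
  ... | inj₂ s<L = subst (_≤ s) (sym (trans (cong (λ z → dist z q) p≡q) (dist-refl q))) 0≤s
    where
    eq′ : (a + s / dist p q * (c - a) , b + s / dist p q * (d - b)) ≡ q
    eq′ = trans (sym (straight-en-route (<⇒≱ s<L))) eq

    p≡q : p ≡ q
    p≡q = cong₂ _,_ (en-route-fraction 0≤s s<L (cong proj₁ eq′)) (en-route-fraction 0≤s s<L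
      (cong proj₂ eq′))

  straight-forward : ∀ {a b σ} → 0# ≤ σ → σ ≤ b - a → straight (a , 0#) (b , 0#) σ ≡ (a + σ , 0#)
  straight-forward {a} {b} {σ} 0≤σ σ≤b-a with ≤⊎> (dist (a , 0#) (b , 0#)) σ
  ... | inj₁ L≤σ = trans (straight-arrived L≤σ) (cong (_, 0#) (trans
    (solve 2 (λ a b → b := a :+ (b :- a)) refl a b)
      (cong (λ z → a + z) (≤-antisym (subst (_≤ σ) L≡ L≤σ) σ≤b-a))))
    where
    L≡ : dist (a , 0#) (b , 0#) ≡ b - a
    L≡ = dist-axis (≤-by (≤-trans 0≤σ σ≤b-a) refl)
  ... | inj₂ σ<L = trans (straight-en-route (<⇒≱ σ<L)) (cong₂ _,_
      (cong (λ z → a + z) (trans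
        (cong (λ z → σ / dist (a , 0#) (b , 0#) * z) (sym L≡)) (/-cancelʳ σ (>⇒≢
          (≤-<-trans 0≤σ σ<L)))))
      (solve 1 (λ k → :0 :+ k :* (:0 :- :0) := :0) refl _))
    where
    L≡ : dist (a , 0#) (b , 0#) ≡ b - a
    L≡ = dist-axis (≤-by (≤-trans 0≤σ σ≤b-a) refl)

  straight-backward : ∀ {a b σ} → 0# ≤ σ → σ ≤ a - b → straight (a , 0#) (b , 0#) σ ≡ (a - σ , 0#)
  straight-backward {a} {b} {σ} 0≤σ σ≤a-b with ≤⊎> (dist (a , 0#) (b , 0#)) σ
  ... | inj₁ L≤σ = trans (straight-arrived L≤σ) (cong (_, 0#) (trans
    (solve 2 (λ a b → b := a :- (a :- b)) refl a b)
      (cong (λ z → a - z) (≤-antisym (subst (_≤ σ) L≡ L≤σ) σ≤a-b))))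
    where
    L≡ : dist (a , 0#) (b , 0#) ≡ a - b
    L≡ = trans (dist-sym _ _) (dist-axis (≤-by (≤-trans 0≤σ σ≤a-b) refl))
  ... | inj₂ σ<L = trans (straight-en-route (<⇒≱ σ<L)) (cong₂ _,_
      (trans (solve 3 (λ a b k → a :+ k :* (b :- a) := a :- k :* (a :- b))
        refl a b (σ / dist (a , 0#) (b , 0#)))
        (cong (λ z → a - z) (trans
          (cong (λ z → σ / dist (a , 0#) (b , 0#) * z) (sym L≡)) (/-cancelʳ σ (>⇒≢
            (≤-<-trans 0≤σ σ<L))))))
      (solve 1 (λ k → :0 :+ k :* (:0 :- :0) := :0) refl _))
    where
    L≡ : dist (a , 0#) (b , 0#) ≡ a - b
    L≡ = trans (dist-sym _ _) (dist-axis (≤-by (≤-trans 0≤σ σ≤a-b) refl))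

  via-first-leg : ∀ {p q r s} → s ≤ dist p q → straightVia p q r s ≡ straight p q s
  via-first-leg = ifᵖ-yes

  via-second-leg : ∀ {p q r s} → dist p q ≤ s → straightVia p q r s ≡ straight q r (s - dist p q)
  via-second-leg {p} {q} {r} {s} L≤s with em {s ≤ dist p q}
  ... | no _    = refl
  -- At the switching time `straightVia` still uses the first leg; both legs are then at `q`.
  ... | yes s≤L = trans (straight-arrived L≤s) (sym (trans (cong (straight q r) (trans
    (cong (λ z → z - dist p q) (≤-antisym s≤L L≤s)) (-‿inverseʳ _))) (straight-start q r)))

  -- Searching for the package along a path

  Finds : (ℝ → Point) → ℝ → ℝ → Set
  Finds γ t u = 0# ≤ u × γ u ≡ package t u

  module Search {γ : ℝ → Point} {t m : ℝ} (isFirst : IsFirst (Finds γ t) m) where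

    after : ∀ {s} → m ≤ s → searchAlong γ t s ≡ straight (γ m) T (s - m)
    after {s} m≤s with em {∃ λ m → m ≤ s × IsFirst (λ u → 0# ≤ u × γ u ≡ package t u) m}
    ... | yes (m′ , _ , found , first) = cong (λ z →
      straight (γ z) T (s - z)) (≤-antisym (first m (proj₁ isFirst)) (proj₂ isFirst m′ found))
    ... | no ∄m = ⊥-elim (∄m (m , m≤s , isFirst))

    before : ∀ {s} → ¬ m ≤ s → searchAlong γ t s ≡ γ s
    before {s} m≰s with em {∃ λ m → m ≤ s × IsFirst (λ u → 0# ≤ u × γ u ≡ package t u) m}
    ... | yes (m′ , m′≤s , found , _) = ⊥-elim (m≰s (≤-trans (proj₂ isFirst m′ found) m′≤s))
    ... | no _ = refl

    -- Before `m` the algorithm follows `γ`, so an earlier meeting would be an earlier find of `γ`.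
    -- From `m` on it heads straight for T.
    delivery : IsFirst (DeliveredAt (searchAlong γ) t) (m + dist (γ m) T)
    delivery = (0≤m ⊞ dist-nonneg _ _ , arrived , m , 0≤m , m≤m+L , met) , first
      where
      L : ℝ
      L = dist (γ m) T

      0≤m : 0# ≤ m
      0≤m = proj₁ (proj₁ isFirst)

      m≤m+L : m ≤ m + L
      m≤m+L = ≤-by (dist-nonneg _ _) (solve 2 (λ m L → m :+ L :- m := L) refl m L)

      arrived : searchAlong γ t (m + L) ≡ T
      arrived = trans (after m≤m+L) (straight-arrived (≤-reflexive
        (solve 2 (λ m L → L := m :+ L :- m) refl m L)))

      met : CoLocated (searchAlong γ) t m
      met = trans (after ≤-refl) (trans (cong (straight (γ m) T) (-‿inverseʳ m))
        (trans (straight-start (γ m) T) (proj₂ (proj₁ isFirst))))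

      m≤met : ∀ u → 0# ≤ u → CoLocated (searchAlong γ) t u → m ≤ u
      m≤met u 0≤u met-u with em {m ≤ u}
      ... | yes m≤u = m≤u
      ... | no  m≰u = proj₂ isFirst u (0≤u , trans (sym (before m≰u)) met-u)

      first : ∀ s → DeliveredAt (searchAlong γ) t s → m + L ≤ s
      first s (_ , atT , u , 0≤u , u≤s , met-u) =
        ≤-by (Δ (straight-arrives-only-after-dist (Δ m≤s) (trans (sym (after m≤s)) atT)))
             (solve 3 (λ m L s → s :- (m :+ L) := s :- m :- L) refl m L s)
        where
        m≤s : m ≤ s
        m≤s = ≤-trans (m≤met u 0≤u met-u) u≤s

  axis-delivery : ∀ {γ t m a} → IsFirst (Finds γ t) m → γ m ≡ (a , 0#) → a ≤ 1# →
                  IsFirst (DeliveredAt (searchAlong γ) t) (m + (1# - a))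
  axis-delivery {γ} {t} {m} isFirst γm a≤1 = subst (IsFirst (DeliveredAt (searchAlong γ) t))
    (cong (λ z → m + z) (trans
      (cong (λ p → dist p T) γm) (dist-axis a≤1))) (Search.delivery isFirst)

  ≡⊓⇒ : ∀ {w s t} → w ≡ s ⊓ t → w ≤ s × w ≤ t
  ≡⊓⇒ {s = s} {t} refl = x⊓y≤x s t , x⊓y≤y s t

  -- The second coordinate vanishes only on arrival, whereas the package is always on the axis.
  first-leg-off-axis : ∀ {x y e s t} → 0# < y → 0# ≤ s → s < dist (x , y) (e , 0#) →
    straight (x , y) (e , 0#) s ≢ package t s
  first-leg-off-axis 0<y 0≤s s<L eq =
    >⇒≢ 0<y (en-route-fraction 0≤s s<L (cong proj₂ (trans (sym (straight-en-route (<⇒≱ s<L))) eq)))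

  module Path {P Q R : Point} {t : ℝ}
    (empty-first-leg : ∀ {s} → 0# ≤ s → s < dist P Q → straight P Q s ≢ package t s) where

    γ : ℝ → Point
    γ = straightVia P Q R

    L : ℝ
    L = dist P Q

    0≤L : 0# ≤ L
    0≤L = dist-nonneg P Q

    second-leg : ∀ {s} → L ≤ s → γ s ≡ straight Q R (s - L)
    second-leg = via-second-leg

    second-leg+ : ∀ {σ} → 0# ≤ σ → γ (L + σ) ≡ straight Q R σ
    second-leg+ {σ} 0≤σ = trans (second-leg (≤-by 0≤σ
      (solve 2 (λ L σ → L :+ σ :- L := σ) refl L σ)))
      (cong (straight Q R) (solve 2 (λ L σ → L :+ σ :- L := σ) refl L σ))

    finds-first : ∀ {σ} → 0# ≤ σ → straight Q R σ ≡ package t (L + σ) →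
                  (∀ {u} → 0# ≤ u → u < σ → straight Q R u ≢ package t (L + u)) →
                  IsFirst (Finds γ t) (L + σ)
    finds-first {σ} 0≤σ here not-before = ((0≤L ⊞ 0≤σ) , trans (second-leg+ 0≤σ) here) , first
      where
      first : ∀ s → Finds γ t s → L + σ ≤ s
      first s (0≤s , found) with ≤⊎> L s | ≤⊎> (L + σ) s
      ... | _        | inj₁ m≤s = m≤s
      ... | inj₂ s<L | inj₂ _   = ⊥-elim (empty-first-leg 0≤s s<L
        (trans (sym (via-first-leg (proj₁ s<L))) found))
      ... | inj₁ L≤s | inj₂ s<m = ⊥-elim (not-before (Δ L≤s) s-L<σ
        (trans (sym (second-leg L≤s)) (trans found (cong (package t) s≡))))
        where
        s≡ : s ≡ L + (s - L)
        s≡ = solve 2 (λ L s → s := L :+ (s :- L)) refl L s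

        s-L<σ : s - L < σ
        s-L<σ = ≰⇒> λ σ≤ → <⇒≱ s<m (≤-by (Δ σ≤)
          (solve 3 (λ L σ s → s :- (L :+ σ) := s :- L :- σ) refl L σ s))

  -- For u < t the finisher is at (u,0) at time r + u, strictly behind the package. It finds the
  -- package at (t,0), and t cancels from r + t + (1 - t).
  𝓐₀-delivery : ∀ {x y t} → InUnit t → 0# < dist (x , y) S →
    (∀ {s} → 0# ≤ s → s < dist (x , y) S → straight (x , y) S s ≢ package t s) →
    IsFirst (DeliveredAt (𝓐₀ (x , y)) t) (dist (x , y) S + 1#)
  𝓐₀-delivery {x} {y} {t} (0≤t , t≤1) 0<r empty-first-leg = subst (IsFirst (DeliveredAt (𝓐₀
    (x , y)) t))
    (solve 2 (λ r t → r :+ t :+ (:1 :- t) := r :+ :1) refl (dist (x , y) S) t)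
    (axis-delivery (finds-first 0≤t at-t not-before) (trans (second-leg+ 0≤t) (along 0≤t t≤1)) t≤1)
    where
    open Path {x , y} {S} {T} {t} empty-first-leg

    along : ∀ {u} → 0# ≤ u → u ≤ 1# → straight S T u ≡ (u , 0#)
    along {u} 0≤u u≤1 = trans (straight-forward 0≤u (subst (u ≤_)
      (solve 0 (:1 := :1 :- :0) refl) u≤1)) (cong (_, 0#) (+-identityˡ u))

    at-t : straight S T t ≡ package t (L + t)
    at-t = trans (along 0≤t t≤1) (cong (_, 0#) (sym (x≤y⇒y⊓x≈x (≤-by 0≤L
      (solve 2 (λ L t → L :+ t :- t := L) refl L t)))))

    not-before : ∀ {u} → 0# ≤ u → u < t → straight S T u ≢ package t (L + u)
    not-before {u} 0≤u u<t eq with total (L + u) t | cong proj₁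
      (trans (sym (along 0≤u (≤-trans (proj₁ u<t) t≤1))) eq)
    ... | inj₁ _ | u≡L+u = >⇒≢ 0<r (≡-by refl (trans
      (solve 2 (λ L u → :0 :- L := u :- (L :+ u))
        refl L u) (trans (cong (λ z → z - (L + u)) u≡L+u) (-‿inverseʳ (L + u)))) )
    ... | inj₂ _ | u≡t   = proj₂ u<t u≡t

  module Detour {x y e : ℝ} (0<y : 0# < y) (0≤e : 0# ≤ e) (e≤1 : e ≤ 1#) (e≤ρ : e ≤ dist (x , y)
    (e , 0#)) where

    𝓑 : Algorithm
    𝓑 = searchAlong (straightVia (x , y) (e , 0#) S)

    ρ : ℝ
    ρ = dist (x , y) (e , 0#)

    -- Since t ≤ e ≤ ρ, the package has stopped at (t,0) before the finisher turns back at (e,0).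
    delivery-before : ∀ {t} → 0# ≤ t → t ≤ e → IsFirst (DeliveredAt 𝓑 t) (ρ + e + 1# - 2# * t)
    delivery-before {t} 0≤t t≤e = subst (IsFirst (DeliveredAt 𝓑 t))
      (solve 3 (λ ρ e t → ρ :+ (e :- t) :+ (:1 :- t) := ρ :+ e :+ :1 :- :2 :* t) refl ρ e t)
      (axis-delivery (finds-first (Δ t≤e) at-t not-before)
        (trans (second-leg+ (Δ t≤e)) reached) (≤-trans t≤e e≤1))
      where
      open Path {x , y} {e , 0#} {S} {t} (first-leg-off-axis 0<y)

      along : ∀ {u} → 0# ≤ u → u ≤ e → straight (e , 0#) S u ≡ (e - u , 0#)
      along {u} 0≤u u≤e = straight-backward 0≤u (subst (u ≤_)
        (solve 1 (λ e → e := e :- :0) refl e) u≤e)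

      reached : straight (e , 0#) S (e - t) ≡ (t , 0#)
      reached = trans (along (Δ t≤e) (≤-by 0≤t
        (solve 2 (λ e t → e :- (e :- t) := t) refl e t))) (cong (_, 0#)
          (solve 2 (λ e t → e :- (e :- t) := t) refl e t))

      at-t : straight (e , 0#) S (e - t) ≡ package t (L + (e - t))
      at-t = trans reached (cong (_, 0#) (sym (x≤y⇒y⊓x≈x
        (≤-by (Δ e≤ρ ⊞ Δ t≤e ⊞ Δ t≤e)
          (solve 3 (λ ρ e t → ρ :+ (e :- t) :- t := (ρ :- e) :+ (e :- t) :+ (e :- t))
            refl ρ e t)))))

      not-before : ∀ {u} → 0# ≤ u → u < e - t → straight (e , 0#) S u ≢ package t (L + u)
      not-before {u} 0≤u u<e-t eq = <⇒≱ u<e-t (≤-by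
        (Δ (proj₂ (≡⊓⇒ (cong proj₁ (trans (sym (along 0≤u u≤e)) eq)))))
          (solve 3 (λ e t u → u :- (e :- t) := t :- (e :- u)) refl e t u))
        where
        u≤e : u ≤ e
        u≤e = ≤-trans (proj₁ u<e-t) (≤-by 0≤t (solve 2 (λ e t → e :- (e :- t) := t) refl e t))

    -- Finisher and package reach (e,0) simultaneously at time `e`, so no time is lost.
    delivery-after : ∀ {t} → ρ ≡ e → e ≤ t → IsFirst (DeliveredAt 𝓑 t) 1#
    delivery-after {t} ρ≡e e≤t = subst (IsFirst (DeliveredAt 𝓑 t))
      (trans (cong (λ z → z + 0# + (1# - e)) ρ≡e)
        (solve 1 (λ e → e :+ :0 :+ (:1 :- e) := :1) refl e))
      (axis-delivery (finds-first ≤-refl at-e (λ 0≤u u<0 → ⊥-elim (<⇒≱ u<0 0≤u)))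
        (trans (second-leg+ ≤-refl) (straight-start _ _)) e≤1)
      where
      open Path {x , y} {e , 0#} {S} {t} (first-leg-off-axis 0<y)

      at-e : straight (e , 0#) S 0# ≡ package t (L + 0#)
      at-e = trans (straight-start _ _) (cong (_, 0#) (sym (trans (cong (_⊓ t)
        (trans (+-identityʳ L) ρ≡e)) (x≤y⇒x⊓y≈x e≤t))))

  -- From x < 0 the finisher passes S and follows the package. From x > 0 it approaches the package
  -- head-on: if 2t ≤ x, the package has stopped at (t,0) when found at time x - t; otherwise they
  -- meet at time x/2 and delivery is at time 1.
  𝓐₀-on-axis : ∀ {x t} → x ≢ 0# → InUnit t → ∃ λ D →
    IsFirst (DeliveredAt (𝓐₀ (x , 0#)) t) D × D ≤ Opt (x , 0#) t
  𝓐₀-on-axis {x} {t} x≢0 t∈I@(0≤t , t≤1) with total 0# x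
  ... | inj₂ x≤0 = r + 1# , 𝓐₀-delivery t∈I 0<r not-found , ≤-trans (≤-by
      (Δ (subst (t - x ≤_) (dist-sym _ _) (dist≥₁ t 0# x 0#)) ⊞ Δ (≤-reflexive r≡))
      (solve 4 (λ r f x t → f :+ :1 :- t :- (r :+ :1) := f :- (t :- x) :+ ((:0 :- x) :- r))
        refl r (dist (x , 0#) (t , 0#)) x t))
      (via≤Opt x 0# t)
    where
    r : ℝ
    r = dist (x , 0#) S

    r≡ : r ≡ 0# - x
    r≡ = dist-axis x≤0

    0<r : 0# < r
    0<r = subst (0# <_) (sym r≡) (Δ< (x≤0 , x≢0))

    not-found : ∀ {s} → 0# ≤ s → s < r → straight (x , 0#) S s ≢ package t s
    not-found {s} 0≤s s<r eq = <⇒≱ s<r (subst (_≤ s) (sym r≡) (≤-by x+s≥0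
      (solve 2 (λ x s → s :- (:0 :- x) := x :+ s) refl x s)))
      where
      x+s≥0 : 0# ≤ x + s
      x+s≥0 = subst (0# ≤_) (sym (cong proj₁ (trans (sym (straight-forward 0≤s
        (subst (s ≤_) r≡ (proj₁ s<r)))) eq))) (⊓-glb 0≤s 0≤t)
  ... | inj₁ 0≤x = towards (total (2# * t) x)
    where
    γ : ℝ → Point
    γ = straightVia (x , 0#) S T

    r≡ : dist (x , 0#) S ≡ x
    r≡ = trans (dist-sym _ _) (trans (dist-axis 0≤x) (solve 1 (λ x → x :- :0 := x) refl x))

    along : ∀ {s} → 0# ≤ s → s ≤ x → γ s ≡ (x - s , 0#)
    along {s} 0≤s s≤x = trans (via-first-leg
      (subst (s ≤_) (sym r≡) s≤x)) (straight-backward 0≤s (subst (s ≤_)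
        (solve 1 (λ x → x := x :- :0) refl x) s≤x))

    first : ∀ {m} → m ≤ x → (∀ {s} → x - s ≡ s ⊓ t → m ≤ s) → ∀ s → Finds γ t s → m ≤ s
    first m≤x bound s (0≤s , found) with total s x
    ... | inj₁ s≤x = bound (cong proj₁ (trans (sym (along 0≤s s≤x)) found))
    ... | inj₂ x≤s = ≤-trans m≤x x≤s

    towards : 2# * t ≤ x ⊎ x ≤ 2# * t → ∃ λ D →
      IsFirst (DeliveredAt (𝓐₀ (x , 0#)) t) D × D ≤ Opt (x , 0#) t
    towards (inj₁ 2t≤x) = _ , axis-delivery ((0≤m , trans at-m
      (cong (_, 0#) (sym (x≤y⇒y⊓x≈x t≤m)))) , first m≤x bound) at-m t≤1 ,
        ≤-trans (≤-by (Δ (dist≥₁ x 0# t 0#))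
          (solve 3 (λ f x t → f :+ :1 :- t :- (x :- t :+ (:1 :- t)) := f :- (x :- t))
            refl (dist (x , 0#) (t , 0#)) x t)) (via≤Opt x 0# t)
      where
      t≤m : t ≤ x - t
      t≤m = ≤-by (Δ 2t≤x) (solve 2 (λ x t → x :- t :- t := x :- :2 :* t) refl x t)

      0≤m : 0# ≤ x - t
      0≤m = ≤-trans 0≤t t≤m

      m≤x : x - t ≤ x
      m≤x = ≤-by 0≤t (solve 2 (λ x t → x :- (x :- t) := t) refl x t)

      at-m : γ (x - t) ≡ (t , 0#)
      at-m = trans (along 0≤m m≤x) (cong (_, 0#) (solve 2 (λ x t → x :- (x :- t) := t) refl x t))

      bound : ∀ {s} → x - s ≡ s ⊓ t → x - t ≤ s
      bound {s} eq = ≤-by (Δ (proj₂ (≡⊓⇒ eq)))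
        (solve 3 (λ x t s → s :- (x :- t) := t :- (x :- s)) refl x t s)
    towards (inj₂ x≤2t) = _ , axis-delivery ((0≤h , trans at-h
      (cong (_, 0#) (sym (x≤y⇒x⊓y≈x h≤t)))) , first h≤x bound) at-h (≤-trans h≤t t≤1) ,
        ≤-trans (≤-reflexive (solve 1 (λ h → h :+ (:1 :- h) := :1) refl h)) (1≤Opt (x , 0#) t)
      where
      h : ℝ
      h = ½ * x

      2h≡x : 2# * h ≡ x
      2h≡x = trans (sym (*-assoc 2# ½ x)) (trans (cong (_* x) 2*½≡1) (*-identityˡ x))

      0≤h : 0# ≤ h
      0≤h = ⁻¹-nonneg 0<2 ⊠ 0≤x

      h≤t : h ≤ t
      h≤t = *-cancelˡ-≤ 0<2 (subst (_≤ 2# * t) (sym 2h≡x) x≤2t)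

      x-h≡h : x - h ≡ h
      x-h≡h = trans (cong (λ z → z - h) (sym 2h≡x)) (solve 1 (λ h → :2 :* h :- h := h) refl h)

      h≤x : h ≤ x
      h≤x = ≤-by 0≤h x-h≡h

      at-h : γ h ≡ (h , 0#)
      at-h = trans (along 0≤h h≤x) (cong (_, 0#) x-h≡h)

      bound : ∀ {s} → x - s ≡ s ⊓ t → h ≤ s
      bound {s} eq = *-cancelˡ-≤ 0<2 (subst (_≤ 2# * s) (sym 2h≡x) (≤-by (Δ (proj₁ (≡⊓⇒ eq)))
        (solve 2 (λ x s → :2 :* s :- x := s :- (x :- s)) refl x s)))

  -- Optimality of the hybrid algorithm

  ≤∞-refl : ∀ v → v ≤∞ v
  ≤∞-refl (fin _) = fin≤fin ≤-refl
  ≤∞-refl ∞       = ≤∞-top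

  ≰∞⇒≥∞ : ∀ {u v} → ¬ u ≤∞ v → v ≤∞ u
  ≰∞⇒≥∞ {∞}              _   = ≤∞-top
  ≰∞⇒≥∞ {fin _} {∞}     u≰v = ⊥-elim (u≰v ≤∞-top)
  ≰∞⇒≥∞ {fin _} {fin _} u≰v = fin≤fin (≰⇒≥ λ a≤b → u≰v (fin≤fin a≤b))

  -- Which candidate is good may depend on the competing algorithm, but the smaller ratio is at most
  -- `c` in either case.
  better-of : ∀ {P X Y c} → CR P X ≤∞ fin c ⊎ CR P Y ≤∞ fin c →
              CR P (ifᵖ CR P X ≤∞ CR P Y then X else Y) ≤∞ fin c
  better-of {P} {X} {Y} {c} good = ifᵖ-elim (λ B → CR P B ≤∞ fin c)
    (λ X≤Y → [ id , ≤∞-trans X≤Y ]′ good)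
    (λ X≰Y → [ ≤∞-trans (≰∞⇒≥∞ X≰Y) , id ]′ good)

  hybrid-≤-𝓐₀ : ∀ {x y c} → CR (x , y) (𝓐₀ (x , y)) ≤∞ fin c → CR (x , y) (hybrid (x , y)) ≤∞ fin c
  hybrid-≤-𝓐₀ {x} {y} {c} le = ifᵖ-elim (λ B → CR (x , y) B ≤∞ fin c) (λ _ →
    better-of (inj₁ le)) (λ _ → better-of (inj₁ le))

  module OffAxis {x y : ℝ} (0<y : 0# < y) where

    P : Point
    P = x , y

    -- Squaring cancels m² and leaves a condition linear in `m`; for x > 0 its threshold is d, where
    -- (d,0) is equidistant from P and S.
    moving : ∀ {m} → 0# ≤ m → dist P (m , 0#) ≤ m → sq x + sq y ≤ 2# * x * m
    moving {m} 0≤m f≤m = ≤-by (Δ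
      (subst (_≤ sq m) (sq-dist x y m 0#) (sq-mono-≤ (dist-nonneg _ _) f≤m)))
      (solve 3 (λ x y m → :2 :* x :* m :- (x :* x :+ y :* y) := m :* m :- ((x :- m) :* (x :- m)
        :+ (y :- :0) :* (y :- :0))) refl x y m)

    0<y² : 0# < sq y
    0<y² = *-pos 0<y 0<y

    0<r² : 0# < sq x + sq y
    0<r² = <-≤-trans 0<y² (≤-by (sq-nonneg x)
      (solve 2 (λ u v → u :+ v :- v := u) refl (sq x) (sq y)))

    y≤r : y ≤ dist P S
    y≤r = ≤-trans (≤-reflexive (solve 1 (λ y → y := y :- :0) refl y)) (dist≥₂ x y 0# 0#)

    0<r : 0# < dist P S
    0<r = <-≤-trans 0<y y≤r

    module _ {A : Algorithm} (isOnline : IsOnline P A) {c : ℝ} (CR≤c : CR P A ≤∞ fin c) where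

      open LowerBound isOnline (CR≤⇒delivery CR≤c) using (1≤c; 0≤c; module Dichotomy)

      ≤c* : ∀ {D o} → 0# ≤ o → D ≤ o → D ≤ c * o
      ≤c* {D} {o} 0≤o D≤o = ≤-by (Δ 1≤c ⊠ 0≤o ⊞ Δ D≤o)
        (solve 3 (λ c o D → c :* o :- D := (c :- :1) :* o :+ (o :- D)) refl c o D)

      𝓐₀-guarantees : dist P S + 1# ≤ c * Opt P 1# → Guarantees P (𝓐₀ P) c
      𝓐₀-guarantees r+1≤ t t∈I@(_ , t≤1) = dist P S + 1# , 𝓐₀-delivery t∈I 0<r
        (first-leg-off-axis 0<y) ,
        ≤-trans r+1≤ (≤-by (0≤c ⊠ Δ (Opt-antitone x y t≤1))
          (solve 3 (λ c o o′ → c :* o :- c :* o′ := c :* (o :- o′)) refl c (Opt P t) (Opt P 1#)))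

      -- The last hypothesis is vacuous for e = 1. For e = d it lets the finisher intercept the
      -- moving package when t > e.
      optimal-pair : ∀ {e} → 0# ≤ e → e ≤ 1# → e ≤ dist P (e , 0#) →
        (∀ {m} → 0# ≤ m → m ≤ 1# → dist P (m , 0#) ≤ m → e ≤ m) →
        (∀ {m} → 0# ≤ m → dist P (m ⊓ 1# , 0#) ≤ m → dist P (e , 0#) + e ≤ m + m ⊓ 1#) →
        (∀ {t} → t ≤ 1# → e < t → dist P (e , 0#) ≡ e) →
        CR P (𝓐₀ P) ≤∞ fin c ⊎ CR P (searchAlong (straightVia P (e , 0#) S)) ≤∞ fin c
      optimal-pair {e} 0≤e e≤1 e≤ρ moving≥e meeting≥ρ ρ≡e =
        Sum.map (λ r+1≤ → guarantees⇒CR≤ (𝓐₀-guarantees r+1≤)) (λ K≤ →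
          guarantees⇒CR≤ (𝓑-guarantees K≤))
                (Dichotomy.dichotomy 0<y 0≤e e≤1 e≤ρ moving≥e meeting≥ρ)
        where
        open Detour 0<y 0≤e e≤1 e≤ρ

        0≤Opt : ∀ t → 0# ≤ Opt P t
        0≤Opt t = proj₁ (0<Opt P t)

        𝓑-guarantees : (∀ t → 0# ≤ t → t < e →
          ρ + e + 1# - 2# * t ≤ c * (dist P (t , 0#) + 1# - t)) → Guarantees P 𝓑 c
        𝓑-guarantees K≤ t (0≤t , t≤1) with ≤⊎> t e | ≤⊎> e t
        ... | inj₂ e<t | _        = 1# , delivery-after (ρ≡e t≤1 e<t) (proj₁ e<t) , ≤c*
          (0≤Opt t) (1≤Opt P t)
        ... | inj₁ t≤e | inj₂ t<e = _ , delivery-before 0≤t t≤e , ≤-trans (K≤ t 0≤t t<e)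
          (≤-by (0≤c ⊠ Δ (via≤Opt x y t))
            (solve 3 (λ c o o′ → c :* o :- c :* o′ := c :* (o :- o′))
              refl c (Opt P t) (dist P (t , 0#) + 1# - t)))
        -- The dichotomy leaves out t = e, but there the detour delivers at f + 1 - t, which is at
        -- most Opt(t).
        ... | inj₁ t≤e | inj₁ e≤t = _ , delivery-before 0≤t t≤e , ≤c* (0≤Opt t)
          (subst (λ z → ρ + z + 1# - 2# * t ≤ Opt P t) t≡e
            (subst (λ z → dist P (z , 0#) + t + 1# - 2# * t ≤ Opt P t) t≡e
              (≤-trans (≤-reflexive (solve 2 (λ f t → f :+ t :+ :1 :- :2 :* t := f :+ :1 :- t)
                refl (dist P (t , 0#)) t)) (via≤Opt x y t))))
          where
          t≡e : t ≡ e
          t≡e = ≤-antisym t≤e e≤t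

      -- Strictly outside the unit disc around T, no (m,0) with m ≤ 1 is reachable by time m, so for
      -- fail time 1 the meeting is at T.
      far : 1# < sq (x - 1#) + sq y → CR P (𝓐₀ P) ≤∞ fin c ⊎ CR P (𝓐₁ P) ≤∞ fin c
      far 1<q² = optimal-pair 0≤1 ≤-refl 1≤q (λ 0≤m m≤1 f≤m →
        ⊥-elim (no-moving 0≤m m≤1 f≤m)) meeting≥q (λ t≤1 1<t → ⊥-elim (<⇒≱ 1<t t≤1))
        where
        1≤q : 1# ≤ dist P T
        1≤q = sq-cancel-≤ (dist-nonneg _ _) (subst (sq 1# ≤_) (sym (sq-dist x y 1# 0#))
          (≤-by (Δ (proj₁ 1<q²)) (solve 2 (λ x y → (x :- :1) :* (x :- :1)
            :+ (y :- :0) :* (y :- :0) :- :1 :* :1 := (x :- :1) :* (x :- :1)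
              :+ y :* y :- :1) refl x y)))

        no-moving : ∀ {m} → 0# ≤ m → m ≤ 1# → ¬ dist P (m , 0#) ≤ m
        no-moving {m} 0≤m m≤1 f≤m with total 0# x
        ... | inj₁ 0≤x = <⇒≱ 1<q² (≤-by (Δ (moving 0≤m f≤m) ⊞ 0≤2 ⊠ 0≤x ⊠ Δ m≤1)
          (solve 3 (λ x y m → :1 :- ((x :- :1) :* (x :- :1) :+ y :* y)
            := (:2 :* x :* m :- (x :* x :+ y :* y)) :+ :2 :* x :* (:1 :- m)) refl x y m))
        ... | inj₂ x≤0 = <⇒≱ 0<r² (≤-trans (moving 0≤m f≤m) (≤-by (0≤2 ⊠ Δ x≤0 ⊠ 0≤m)
          (solve 2 (λ x m → :0 :- :2 :* x :* m := :2 :* (:0 :- x) :* m) refl x m)))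

        meeting≥q : ∀ {m} → 0# ≤ m → dist P (m ⊓ 1# , 0#) ≤ m → dist P T + 1# ≤ m + m ⊓ 1#
        meeting≥q {m} 0≤m f≤m with total m 1#
        ... | inj₁ m≤1 = ⊥-elim (no-moving 0≤m m≤1 f≤m)
        ... | inj₂ 1≤m = +-monoˡ-≤ 1# f≤m

      -- In the unit disc around T, r² ≤ 2x. Hence x > 0 and d ≤ 1, and both m and its minimum with
      -- 1 are at least d at a meeting.
      near : ¬ 1# < sq (x - 1#) + sq y → CR P (𝓐₀ P) ≤∞ fin c ⊎ CR P (𝓐d P) ≤∞ fin c
      near 1≮q² = optimal-pair 0≤d d≤1 (≤-reflexive (sym ρ≡d)) (λ 0≤m _ →
        moving≥d 0≤m) meeting≥d (λ _ _ → ρ≡d)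
        where
        r²≤2x : sq x + sq y ≤ 2# * x
        r²≤2x with ≤⊎> (sq (x - 1#) + sq y) 1#
        ... | inj₁ q²≤1 = ≤-by (Δ q²≤1)
          (solve 2 (λ x y → :2 :* x :- (x :* x :+ y :* y) := :1 :- ((x :- :1) :* (x :- :1)
            :+ y :* y)) refl x y)
        ... | inj₂ 1<q² = ⊥-elim (1≮q² 1<q²)

        0<2x : 0# < 2# * x
        0<2x = <-≤-trans 0<r² r²≤2x

        d : ℝ
        d = (sq x + sq y) / (2# * x)

        2xd≡r² : d * (2# * x) ≡ sq x + sq y
        2xd≡r² = /-cancelʳ _ (>⇒≢ 0<2x)

        0≤d : 0# ≤ d
        0≤d = proj₁ 0<r² ⊠ ⁻¹-nonneg 0<2x

        d≤1 : d ≤ 1#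
        d≤1 = ≤-*⇒/-≤ 0<2x (subst (sq x + sq y ≤_) (sym (*-identityˡ _)) r²≤2x)

        ρ≡d : dist P (d , 0#) ≡ d
        ρ≡d = dist-unique 0≤d (≡-by (trans
          (cong (λ z → z - d * (2# * x)) (sym 2xd≡r²)) (-‿inverseʳ _))
          (solve 3 (λ x y d → (x :- d) :* (x :- d) :+ (y :- :0) :* (y :- :0) :- d :* d := x :* x
            :+ y :* y :- d :* (:2 :* x)) refl x y d))

        moving≥d : ∀ {m} → 0# ≤ m → dist P (m , 0#) ≤ m → d ≤ m
        moving≥d {m} 0≤m f≤m = ≤-*⇒/-≤ 0<2x
          (subst (sq x + sq y ≤_) (*-comm (2# * x) m) (moving 0≤m f≤m))

        meeting≥d : ∀ {m} → 0# ≤ m → dist P (m ⊓ 1# , 0#) ≤ m → dist P (d , 0#) + d ≤ m + m ⊓ 1#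
        meeting≥d {m} 0≤m f≤m = subst (λ z → z + d ≤ m + m ⊓ 1#) (sym ρ≡d)
          (≤-by (Δ (≤-trans d≤m⊓1 (x⊓y≤x m 1#)) ⊞ Δ d≤m⊓1)
            (solve 3 (λ m v d → m :+ v :- (d :+ d) := (m :- d) :+ (v :- d)) refl m (m ⊓ 1#) d))
          where
          d≤m⊓1 : d ≤ m ⊓ 1#
          d≤m⊓1 with total m 1#
          ... | inj₁ m≤1 = moving≥d 0≤m f≤m
          ... | inj₂ 1≤m = d≤1

      hybrid-optimal : CR P (hybrid P) ≤∞ fin c
      hybrid-optimal = ifᵖ-elim (λ B → CR P B ≤∞ fin c) (λ 1<q² → better-of (far 1<q²)) (λ 1≮q² →
        better-of (near 1≮q²))

  hybrid-on-axis : ∀ {x A c} → x ≢ 0# → IsOnline (x , 0#) A → CR (x , 0#) A ≤∞ fin c →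
    CR (x , 0#) (hybrid (x , 0#)) ≤∞ fin c
  hybrid-on-axis {x} {A} {c} x≢0 isOnline CR≤c = hybrid-≤-𝓐₀ (guarantees⇒CR≤ λ t t∈I →
    let D , isFirst , D≤Opt = 𝓐₀-on-axis x≢0 t∈I
    in D , isFirst , ≤-trans D≤Opt (≤-by (Δ 1≤c ⊠ proj₁ (0<Opt (x , 0#) t))
      (solve 2 (λ c o → c :* o :- o := (c :- :1) :* o) refl c (Opt (x , 0#) t))))
    where open LowerBound isOnline (CR≤⇒delivery CR≤c) using (1≤c)

  -- The bound `v` is arbitrary so that it can be matched on: `∞` is trivial, and `fin c` provides
  -- the constant `c`.
  hybrid-≤ : ∀ {x y A} → 0# ≤ y → (x , y) ≢ S → IsOnline (x , y) A → ∀ v → CR (x , y) A ≤∞ v →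
    CR (x , y) (hybrid (x , y)) ≤∞ v
  hybrid-≤ 0≤y P≢S isOnline ∞ _ = ≤∞-top
  hybrid-≤ {x} {y} {A} 0≤y P≢S isOnline (fin c) CR≤c = cases (≤⊎> y 0#)
    where
    Claim : ℝ → Set
    Claim z = (x , z) ≢ S → IsOnline (x , z) A → CR (x , z) A ≤∞ fin c →
              CR (x , z) (hybrid (x , z)) ≤∞ fin c

    on-axis : Claim 0#
    on-axis P≢S = hybrid-on-axis (λ x≡0 → P≢S (cong (_, 0#) x≡0))

    cases : y ≤ 0# ⊎ 0# < y → CR (x , y) (hybrid (x , y)) ≤∞ fin c
    cases (inj₁ y≤0) = subst Claim (≤-antisym 0≤y y≤0) on-axis P≢S isOnline CR≤c
    cases (inj₂ 0<y) = OffAxis.hybrid-optimal 0<y isOnline CR≤c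

theorem4 : (em : ExcludedMiddle 0ℓ) (reals : CompleteOrderedField) →
    let open FaultyStarter em reals in
    (x y : ℝ) → 0# ≤ y → (x , y) ≢ (0# , 0#) →
    (A : Algorithm) → IsOnline (x , y) A →
    CR (x , y) (hybrid (x , y)) ≤∞ CR (x , y) A
theorem4 em reals x y 0≤y P≢S A isOnline = hybrid-≤ 0≤y P≢S isOnline _ (≤∞-refl _)
  where open Optimality em reals
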